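{- As formal power series in $u$ with coefficients in $\mathbb{Q}[t]$, $$\sum_{n\ge1}\chi_{\Pi_{\Gamma_{2n}}}(t)\,u^n=\sum_{n\ge1}\frac{(t-1)_n\,(t-1)_{n-1}\,u^n}{\prod_{k=1}^n\bigl(1-k(t-k)u\bigr)},$$ where $(a)_n=a(a-1)\cdots(a-(n-1))$ (and $(a)_0=1$).
   Context: $\Gamma_{2n}$ is the bipartite graph on vertex set $[2n]=\{1,\dots,2n\}$ with edges $\{2i-1,2j\}$ for $1\le i\le j\le n$. For a finite graph $G$ with vertex set $V$, the bond lattice $\Pi_G$ is the set of partitions $\pi$ of $V$ such that the induced subgraph of $G$ on each block is connected, ordered by: $\pi\le\pi'$ iff every block of $\pi$ is contained in a block of $\pi'$. For a finite ranked poset $P$ of length $\ell$ with minimum $\hat0$, Möbius function $\mu_P$ and rank function $\mathrm{rk}$, the characteristic polynomial is $\chi_P(t)=\sum_{x\in P}\mu_P(\hat0,x)t^{\ell-\mathrm{rk}(x)}$. ($\Pi_{\Gamma_{2n}}$ is isomorphic to the intersection lattice of the homogenized Linial arrangement $\{x_i-x_j=y_i : 1\le i<j\le n+1\}$ in $\mathbb{R}^{2n+1}$.) -}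

module Defs where

open import Algebra.Bundles.Raw using (RawRing)
import Algebra.Definitions.RawSemiring as RawSemiringDefs
open import Data.Bool.Base using (if_then_else_)
open import Data.Bool.Properties using () renaming (_≟_ to _≟ᵇ_)
open import Data.Fin.Base as Fin using (Fin; toℕ)
open import Data.Fin.Properties using (all?; any?) renaming (_≟_ to _≟ᶠ_; _≤?_ to _≤ᶠ?_)
open import Data.Fin.Subset using (Subset; inside; outside; _∈_; _⊆_; ⁅_⁆)
open import Data.Fin.Subset.Properties using (_∈?_; _⊆?_; ⊆-antisym; x∈⁅x⁆; x∈⁅y⁆⇒x≡y)
open import Data.Integer.Base as ℤ using (ℤ; 0ℤ; 1ℤ)
open import Data.List.Base as List using (List; []; _∷_; foldr; filter; length; cartesianProductWith; allFin)
import Data.List.Membership.Propositional as ListMembership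
open import Data.List.Membership.Propositional.Properties using (∈-cartesianProductWith⁺; ∈-allFin)
open import Data.List.Relation.Unary.All as All using (All; []; _∷_)
open import Data.List.Relation.Unary.AllPairs using ([]; _∷_)
open import Data.List.Relation.Unary.Any as Any using (Any; here; there)
open import Data.List.Relation.Unary.Enumerates.Setoid using (IsEnumeration)
open import Data.List.Relation.Unary.Unique.Setoid using (Unique)
open import Data.List.Relation.Unary.Unique.Setoid.Properties using (cartesianProductWith⁺)
open import Data.Nat.Base as ℕ using (ℕ; zero; suc; _⊔_; _∸_; z≤n; s≤s)
open import Data.Nat.Induction using (<-wellFounded)
import Data.Nat.Properties as ℕₚ
open import Data.Product.Base using (_×_; _,_; proj₁; proj₂; ∃; ∃₂; ∃-syntax)
import Data.Rational.Base as ℚ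
open import Data.Sum.Base using (_⊎_; inj₁; inj₂; swap)
open import Data.Vec.Base as Vec using (Vec; []; _∷_; lookup; tabulate; head)
import Data.Vec.Properties as Vecₚ
open import Function.Base using (id; _∘_; _on_)
open import Induction.WellFounded using (Acc; acc; WellFounded)
open import Level using (0ℓ)
open import Relation.Binary.Bundles using (DecPoset)
open import Relation.Binary.Core using (Rel)
import Relation.Binary.Construct.NonStrictToStrict as ToStrict
import Relation.Binary.Construct.On as On
open import Relation.Binary.Construct.Closure.ReflexiveTransitive using (Star; ε; _◅_; _◅◅_)
open import Relation.Binary.Definitions as B using (Minimum)
open import Relation.Binary.PropositionalEquality
  using (_≡_; _≢_; refl; sym; trans; cong; subst; setoid; isEquivalence)
import Relation.Binary.Properties.Poset as Posetₚ
open import Relation.Nullary using (¬_; Dec; yes; no; contradiction)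
open import Relation.Nullary.Decidable as Dec using (_×-dec_; _⊎-dec_; _→-dec_; does)
open import Relation.Unary using (Pred; Decidable)

collect : ∀ {A : Set} {P : Pred A 0ℓ} → Decidable P → List A → List (∃ P)
collect P? []       = []
collect P? (x ∷ xs) with P? x
... | yes px = (x , px) ∷ collect P? xs
... | no  _  = collect P? xs

module _ {A : Set} {P : Pred A 0ℓ} (P? : Decidable P) where

  collect-complete : ∀ {x xs} → P x → x ListMembership.∈ xs →
                     Any (λ z → x ≡ proj₁ z) (collect P? xs)
  collect-complete {xs = y ∷ _} px (here refl) with P? y
  ... | yes _  = here refl
  ... | no ¬py = contradiction px ¬py
  collect-complete {xs = y ∷ _} px (there x∈xs) with P? y
  ... | yes _ = there (collect-complete px x∈xs)
  ... | no  _ = collect-complete px x∈xs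

  collect-All : ∀ {Q : Pred A 0ℓ} {xs} → All Q xs → All (Q ∘ proj₁) (collect P? xs)
  collect-All []                  = []
  collect-All {xs = x ∷ _} (q ∷ qs) with P? x
  ... | yes _ = q ∷ collect-All qs
  ... | no  _ = collect-All qs

  collect-unique : ∀ {xs} → Unique (setoid A) xs →
                   Unique (On.setoid {B = ∃ P} (setoid A) proj₁) (collect P? xs)
  collect-unique []                    = []
  collect-unique {xs = x ∷ _} (x∉ ∷ xs!) with P? x
  ... | yes _ = collect-All x∉ ∷ collect-unique xs!
  ... | no  _ = collect-unique xs!

module _ {A : Set} {P Q : Pred A 0ℓ} (P? : Decidable P) (Q? : Decidable Q)
         (P⊆Q : ∀ {x} → P x → Q x) where

  filter-≤ : ∀ xs → length (filter P? xs) ℕ.≤ length (filter Q? xs)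
  filter-≤ []       = z≤n
  filter-≤ (x ∷ xs) with P? x | Q? x
  ... | yes _  | yes _  = s≤s (filter-≤ xs)
  ... | yes px | no ¬qx = contradiction (P⊆Q px) ¬qx
  ... | no  _  | yes _  = ℕₚ.m≤n⇒m≤1+n (filter-≤ xs)
  ... | no  _  | no  _  = filter-≤ xs

  filter-< : ∀ {xs} → Any (λ x → ¬ P x × Q x) xs →
             length (filter P? xs) ℕ.< length (filter Q? xs)
  filter-< {x ∷ xs} (here (¬px , qx)) with P? x | Q? x
  ... | yes px | _      = contradiction px ¬px
  ... | no  _  | yes _  = s≤s (filter-≤ xs)
  ... | no  _  | no ¬qx = contradiction qx ¬qx
  filter-< {x ∷ xs} (there any) with P? x | Q? x
  ... | yes _  | yes _  = s≤s (filter-< any)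
  ... | yes px | no ¬qx = contradiction (P⊆Q px) ¬qx
  ... | no  _  | yes _  = ℕₚ.m≤n⇒m≤1+n (filter-< any)
  ... | no  _  | no  _  = filter-< any

allVecs : ∀ {A : Set} → List A → ∀ n → List (Vec A n)
allVecs xs zero    = [] ∷ []
allVecs xs (suc n) = cartesianProductWith _∷_ xs (allVecs xs n)

module _ {A : Set} {xs : List A} where

  allVecs-complete : IsEnumeration (setoid A) xs → ∀ {n} → IsEnumeration (setoid (Vec A n)) (allVecs xs n)
  allVecs-complete xs-all []      = here refl
  allVecs-complete xs-all (v ∷ vs) = ∈-cartesianProductWith⁺ _∷_ (xs-all v) (allVecs-complete xs-all vs)

  allVecs-unique : Unique (setoid A) xs → ∀ n → Unique (setoid (Vec A n)) (allVecs xs n)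
  allVecs-unique xs! zero    = [] ∷ []
  allVecs-unique xs! (suc n) =
    cartesianProductWith⁺ (setoid A) (setoid (Vec A n)) (setoid (Vec A (suc n)))
      _∷_ Vecₚ.∷-injective xs! (allVecs-unique xs! n)

allSubsets : ∀ m → List (Subset m)
allSubsets = allVecs (outside ∷ inside ∷ [])

allSubsets-complete : ∀ {m} → IsEnumeration (setoid (Subset m)) (allSubsets m)
allSubsets-complete = allVecs-complete λ where
  outside → here refl
  inside  → there (here refl)

allSubsets-unique : ∀ m → Unique (setoid (Subset m)) (allSubsets m)
allSubsets-unique = allVecs-unique (((λ ()) ∷ []) ∷ [] ∷ [])

record FinitePoset : Set₁ where
  field
    decPoset : DecPoset 0ℓ 0ℓ 0ℓ

  open DecPoset decPoset public

  field
    elements          : List Carrier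
    elements-complete : IsEnumeration Eq.setoid elements
    elements-unique   : Unique Eq.setoid elements
    0̂                 : Carrier
    0̂-minimum         : Minimum _≤_ 0̂

  open Posetₚ poset public using (_<_; <-irrefl; <-trans; <-respˡ-≈)

  _<?_ : B.Decidable _<_
  _<?_ = ToStrict.<-decidable _≈_ _≤_ _≟_ _≤?_

  private
    #below : Carrier → ℕ
    #below y = length (filter (_<? y) elements)

    #below-mono : ∀ {x y} → x < y → #below x ℕ.< #below y
    #below-mono {x} {y} x<y = filter-< (_<? x) (_<? y) (λ z<x → <-trans z<x x<y)
      (Any.map (λ x≈z → <-irrefl (Eq.sym x≈z) , <-respˡ-≈ x≈z x<y) (elements-complete x))

    <-accessible : ∀ {x} → Acc ℕ._<_ (#below x) → Acc _<_ x
    <-accessible (acc rs) = acc λ y<x → <-accessible (rs (#below-mono y<x))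

  <-wf : WellFounded _<_
  <-wf x = <-accessible (<-wellFounded (#below x))

  below : ∀ x → List (∃ λ z → z < x)
  below x = collect (_<? x) elements

  halfOpen : ∀ x y → List (∃ λ z → x ≤ z × z < y)
  halfOpen x y = collect (λ z → (x ≤? z) ×-dec (z <? y)) elements

  -- μ(x, x) = 1 and μ(x, y) = - Σ_{x ≤ z < y} μ(x, z) for x ≠ y; the sum is
  -- empty, so that μ(x, y) = 0, when x ≰ y.
  μ-acc : ∀ x y → Acc _<_ y → ℤ
  μ-acc x y (acc rs) =
    if does (x ≟ y) then 1ℤ
    else ℤ.- foldr ℤ._+_ 0ℤ
      (List.map (λ (z , _ , z<y) → μ-acc x z (rs z<y)) (halfOpen x y))

  μ : Carrier → Carrier → ℤ
  μ x y = μ-acc x y (<-wf y)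

  -- The length k of a longest chain x₀ < x₁ < ... < xₖ = x.  In a ranked poset
  -- with minimum this is the rank of x.
  rk-acc : ∀ x → Acc _<_ x → ℕ
  rk-acc x (acc rs) =
    foldr _⊔_ 0 (List.map (λ (z , z<x) → suc (rk-acc z (rs z<x))) (below x))

  rk : Carrier → ℕ
  rk x = rk-acc x (<-wf x)

  -- The length of a longest chain in the whole poset.
  len : ℕ
  len = foldr _⊔_ 0 (List.map rk elements)

-- A polynomial is a list of coefficients, constant term first; trailing zeros
-- are identified away by _≈_.
module Polynomial (R : RawRing 0ℓ 0ℓ) where
  open RawRing R renaming
    (_≈_ to _≈ᴿ_; _+_ to _+ᴿ_; _*_ to _*ᴿ_; -_ to -ᴿ_)

  Poly : Set
  Poly = List Carrier

  coeff : Poly → ℕ → Carrier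
  coeff []      _       = 0#
  coeff (a ∷ p) zero    = a
  coeff (a ∷ p) (suc i) = coeff p i

  infix  4 _≈_
  infixl 6 _+_
  infixl 7 _*_

  _≈_ : Rel Poly 0ℓ
  p ≈ q = ∀ i → coeff p i ≈ᴿ coeff q i

  _+_ : Poly → Poly → Poly
  []      + q       = q
  (a ∷ p) + []      = a ∷ p
  (a ∷ p) + (b ∷ q) = (a +ᴿ b) ∷ (p + q)

  _*_ : Poly → Poly → Poly
  []      * q = []
  (a ∷ p) * q = List.map (a *ᴿ_) q + (0# ∷ p * q)

  const : Carrier → Poly
  const a = a ∷ []

  var : Poly
  var = 0# ∷ 1# ∷ []

  rawRing : RawRing 0ℓ 0ℓ
  rawRing = record
    { Carrier = Poly
    ; _≈_     = _≈_
    ; _+_     = _+_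
    ; _*_     = _*_
    ; -_      = List.map -ᴿ_
    ; 0#      = []
    ; 1#      = const 1#
    }

module PowerSeries (R : RawRing 0ℓ 0ℓ) where
  open RawRing R renaming
    (_≈_ to _≈ᴿ_; _+_ to _+ᴿ_; _*_ to _*ᴿ_; -_ to -ᴿ_)
  open RawSemiringDefs rawSemiring using (sum)

  Series : Set
  Series = ℕ → Carrier

  const : Carrier → Series
  const a zero    = a
  const a (suc _) = 0#

  var : Series
  var 1 = 1#
  var _ = 0#

  rawRing : RawRing 0ℓ 0ℓ
  rawRing = record
    { Carrier = Series
    ; _≈_     = λ f g → ∀ m → f m ≈ᴿ g m
    ; _+_     = λ f g m → f m +ᴿ g m
    ; _*_     = λ f g m → sum {suc m} λ i → f (toℕ i) *ᴿ g (m ∸ toℕ i)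
    ; -_      = λ f m → -ᴿ f m
    ; 0#      = const 0#
    ; 1#      = const 1#
    }

  -- The inverse h of a series g with constant term 1: comparing coefficients in
  -- g * h = 1 gives h₀ = 1 and hₘ₊₁ = - Σ_{i ≤ m} gᵢ₊₁ hₘ₋ᵢ.  The vector holds
  -- hₘ, hₘ₋₁, ..., h₀ in this order.
  inverseCoeffs : Series → ∀ m → Vec Carrier (suc m)
  inverseCoeffs g zero    = 1# ∷ []
  inverseCoeffs g (suc m) =
    (-ᴿ sum {suc m} λ i → g (suc (toℕ i)) *ᴿ lookup hs i) ∷ hs
    where hs = inverseCoeffs g m

  inverse : Series → Series
  inverse g m = head (inverseCoeffs g m)

  -- Σ_{n ≥ 1} f n = s: every coefficient of the partial sums f 1 + ... + f N is
  -- eventually that of s.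
  Σ≥1_HasSum_ : (ℕ → Series) → Series → Set
  Σ≥1 f HasSum s =
    ∀ m → ∃[ N₀ ] ∀ N → N₀ ℕ.≤ N → sum {N} (λ i → f (suc (toℕ i)) m) ≈ᴿ s m

ℚ[t] : RawRing 0ℓ 0ℓ
ℚ[t] = Polynomial.rawRing ℚ.+-*-rawRing

ℚ[t]⟦u⟧ : RawRing 0ℓ 0ℓ
ℚ[t]⟦u⟧ = PowerSeries.rawRing ℚ[t]

open PowerSeries ℚ[t] public using (Series; inverse; Σ≥1_HasSum_)

t : RawRing.Carrier ℚ[t]
t = Polynomial.var ℚ.+-*-rawRing

constₜ : ℚ.ℚ → RawRing.Carrier ℚ[t]
constₜ = Polynomial.const ℚ.+-*-rawRing

u : Series
u = PowerSeries.var ℚ[t]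

constᵤ : RawRing.Carrier ℚ[t] → Series
constᵤ = PowerSeries.const ℚ[t]

module RingNotation (R : RawRing 0ℓ 0ℓ) where
  open RawRing R public
  open RawSemiringDefs rawSemiring public using (_^_; product) renaming (_×_ to _·_)

  infixl 6 _-_
  _-_ : Carrier → Carrier → Carrier
  x - y = x + - y

  fromℕ : ℕ → Carrier
  fromℕ n = n · 1#

  falling : Carrier → ℕ → Carrier
  falling a n = product {n} λ i → a - fromℕ (toℕ i)

-- Subscripts tell the operations of ℚ[t] from those of ℚ[t]⟦u⟧.
open RingNotation ℚ[t] public using () renaming
  (_*_ to _*ₜ_; _-_ to _-ₜ_; 1# to 1ₜ; fromℕ to fromℕₜ; falling to fallingₜ)
open RingNotation ℚ[t]⟦u⟧ public using () renaming
  (_*_ to _*ᵤ_; _-_ to _-ᵤ_; 1# to 1ᵤ; _^_ to _^ᵤ_; product to productᵤ)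

-- The subtraction is exact, as rk x ≤ len for every x in elements.
χ : FinitePoset → RawRing.Carrier ℚ[t]
χ P = foldr _+_ 0# (List.map (λ x → constₜ (μ 0̂ x ℚ./ 1) * t ^ (len ∸ rk x)) elements)
  where
    open FinitePoset P
    open RingNotation ℚ[t] using (_+_; 0#; _*_; _^_)

record Graph (m : ℕ) : Set₁ where
  field
    Edge        : Rel (Fin m) 0ℓ
    edge?       : B.Decidable Edge
    edge-sym    : B.Symmetric Edge
    edge-irrefl : B.Irreflexive _≡_ Edge

  InducedEdge : Subset m → Rel (Fin m) 0ℓ
  InducedEdge S v w = v ∈ S × w ∈ S × Edge v w

  Connected : Subset m → Set
  Connected S = ∀ {v w} → v ∈ S → w ∈ S → Star (InducedEdge S) v w

-- Reachability in a finite relation is decidable, by Warshall's algorithm: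
-- Via xs v w says that w is reachable from v through intermediate points in xs.
module Reachability {m : ℕ} {E : Rel (Fin m) 0ℓ} (E? : B.Decidable E) where

  Via : List (Fin m) → Rel (Fin m) 0ℓ
  Via []       v w = v ≡ w ⊎ E v w
  Via (x ∷ xs) v w = Via xs v w ⊎ (Via xs v x × Via xs x w)

  via? : ∀ xs → B.Decidable (Via xs)
  via? []       v w = (v ≟ᶠ w) ⊎-dec E? v w
  via? (x ∷ xs) v w = via? xs v w ⊎-dec (via? xs v x ×-dec via? xs x w)

  via⇒star : ∀ xs {v w} → Via xs v w → Star E v w
  via⇒star []       (inj₁ refl)    = ε
  via⇒star []       (inj₂ e)       = e ◅ ε
  via⇒star (x ∷ xs) (inj₁ p)       = via⇒star xs p
  via⇒star (x ∷ xs) (inj₂ (p , q)) = via⇒star xs p ◅◅ via⇒star xs q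

  via-base : ∀ xs {v w} → Via [] v w → Via xs v w
  via-base []       p = p
  via-base (x ∷ xs) p = inj₁ (via-base xs p)

  via-trans : ∀ {xs x} → x ListMembership.∈ xs → ∀ {v w} → Via xs v x → Via xs x w → Via xs v w
  via-trans (here refl) (inj₁ p)       (inj₁ q)       = inj₂ (p , q)
  via-trans (here refl) (inj₁ p)       (inj₂ (_ , q)) = inj₂ (p , q)
  via-trans (here refl) (inj₂ (p , _)) (inj₁ q)       = inj₂ (p , q)
  via-trans (here refl) (inj₂ (p , _)) (inj₂ (_ , q)) = inj₂ (p , q)
  via-trans (there x∈) (inj₁ p)       (inj₁ q)       = inj₁ (via-trans x∈ p q)
  via-trans (there x∈) (inj₁ p)       (inj₂ (q , r)) = inj₂ (via-trans x∈ p q , r)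
  via-trans (there x∈) (inj₂ (p , q)) (inj₁ r)       = inj₂ (p , via-trans x∈ q r)
  via-trans (there x∈) (inj₂ (p , _)) (inj₂ (_ , r)) = inj₂ (p , r)

  star⇒via : ∀ {v w} → Star E v w → Via (allFin m) v w
  star⇒via ε       = via-base (allFin m) (inj₁ refl)
  star⇒via (e ◅ p) = via-trans (∈-allFin _) (via-base (allFin m) (inj₂ e)) (star⇒via p)

  star? : B.Decidable (Star E)
  star? v w = Dec.map′ (via⇒star (allFin m)) star⇒via (via? (allFin m) v w)

-- A partition of Fin m is given by the vector b listing, for each point i, the
-- block containing i; this determines and is determined by the set of blocks.
record IsPartition {m : ℕ} (b : Vec (Subset m) m) : Set where
  field
    self : ∀ i → i ∈ lookup b i
    same : ∀ i j → j ∈ lookup b i → lookup b j ≡ lookup b i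

Refines : ∀ {m} → Rel (Vec (Subset m) m) 0ℓ
Refines b b′ = ∀ i → ∃[ j ] lookup b i ⊆ lookup b′ j

module _ {m : ℕ} where

  isPartition? : Decidable (IsPartition {m})
  isPartition? b =
    Dec.map′ (λ (p , q) → record { self = p ; same = q })
             (λ p → IsPartition.self p , IsPartition.same p)
      (all? (λ i → i ∈? lookup b i) ×-dec
       all? (λ i → all? λ j → (j ∈? lookup b i) →-dec
         Vecₚ.≡-dec _≟ᵇ_ (lookup b j) (lookup b i)))

  refines? : B.Decidable (Refines {m})
  refines? b b′ = all? λ i → any? λ j → lookup b i ⊆? lookup b′ j

  refines-⊆ : ∀ {b b′ : Vec (Subset m) m} → IsPartition b → IsPartition b′ →
              Refines b b′ → ∀ i → lookup b i ⊆ lookup b′ i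
  refines-⊆ {b} {b′} P P′ r i {x} x∈ with r i
  ... | j , bi⊆b′j = subst (x ∈_) (sym (IsPartition.same P′ j i (bi⊆b′j (IsPartition.self P i)))) (bi⊆b′j x∈)

  refines-antisym : ∀ {b b′ : Vec (Subset m) m} → IsPartition b → IsPartition b′ →
                    Refines b b′ → Refines b′ b → b ≡ b′
  refines-antisym {b} {b′} P P′ r r′ =
    trans (sym (Vecₚ.tabulate∘lookup b))
      (trans (Vecₚ.tabulate-cong λ i → ⊆-antisym (refines-⊆ P P′ r i) (refines-⊆ P′ P r′ i))
        (Vecₚ.tabulate∘lookup b′))

  refines-trans : ∀ {b b′ b″ : Vec (Subset m) m} → Refines b b′ → Refines b′ b″ → Refines b b″
  refines-trans r r′ i =
    let (j , bi⊆) = r i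
        (k , b′j⊆) = r′ j
    in  k , λ x∈ → b′j⊆ (bi⊆ x∈)

  discrete : Vec (Subset m) m
  discrete = tabulate ⁅_⁆

  discrete-block : ∀ {i j} → i ∈ lookup discrete j → i ≡ j
  discrete-block {i} {j} i∈ = x∈⁅y⁆⇒x≡y j (subst (i ∈_) (Vecₚ.lookup∘tabulate ⁅_⁆ j) i∈)

  discrete-self : ∀ i → i ∈ lookup discrete i
  discrete-self i = subst (i ∈_) (sym (Vecₚ.lookup∘tabulate ⁅_⁆ i)) (x∈⁅x⁆ i)

  discrete-isPartition : IsPartition discrete
  discrete-isPartition = record
    { self = discrete-self
    ; same = λ i j j∈ → cong (lookup discrete) (discrete-block j∈)
    }

module _ {m : ℕ} (G : Graph m) where
  open Graph G

  connected? : Decidable Connected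
  connected? S =
    Dec.map′ {A = ∀ v w → v ∈ S → w ∈ S → Star (InducedEdge S) v w}
      (λ c {v} {w} → c v w) (λ c v w → c {v} {w})
      (all? λ v → all? λ w → (v ∈? S) →-dec ((w ∈? S) →-dec
        Reachability.star? (λ x y → (x ∈? S) ×-dec ((y ∈? S) ×-dec edge? x y)) v w))

  IsBond : Pred (Vec (Subset m) m) 0ℓ
  IsBond b = IsPartition b × (∀ i → Connected (lookup b i))

  isBond? : Decidable IsBond
  isBond? b = isPartition? b ×-dec all? λ i → connected? (lookup b i)

  discrete-isBond : IsBond discrete
  discrete-isBond = discrete-isPartition , λ i v∈ w∈ →
    subst (Star _ _) (trans (discrete-block v∈) (sym (discrete-block w∈))) ε

  bondLattice : FinitePoset
  bondLattice = record
    { decPoset = record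
      { Carrier = ∃ IsBond
      ; _≈_     = _≡_ on proj₁
      ; _≤_     = Refines on proj₁
      ; isDecPartialOrder = record
        { isPartialOrder = record
          { isPreorder = record
            { isEquivalence = On.isEquivalence proj₁ isEquivalence
            ; reflexive     = λ { refl i → i , id }
            ; trans         = λ { {b , _} {b′ , _} {b″ , _} → refines-trans {b = b} {b′} {b″} }
            }
          ; antisym = λ { {_ , P , _} {_ , P′ , _} → refines-antisym P P′ }
          }
        ; _≟_  = λ (b , _) (b′ , _) → Vecₚ.≡-dec (Vecₚ.≡-dec _≟ᵇ_) b b′
        ; _≤?_ = λ (b , _) (b′ , _) → refines? b b′
        }
      }
    ; elements          = collect isBond? (allVecs (allSubsets m) m)
    ; elements-complete = λ (b , p) → collect-complete isBond? p (allVecs-complete allSubsets-complete b)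
    ; elements-unique   = collect-unique isBond? (allVecs-unique (allSubsets-unique m) m)
    ; 0̂                 = discrete , discrete-isBond
    ; 0̂-minimum         = λ (b , P , _) i → i , λ x∈ →
        subst (_∈ lookup b i) (sym (discrete-block x∈)) (IsPartition.self P i)
    }

-- Fin k stands for {1, ..., k}.
label : ∀ {k} → Fin k → ℕ
label i = suc (toℕ i)

private
  odd≢even : ∀ {a b : ℕ} i j → a ≡ 2 ℕ.* suc i ∸ 1 → b ≡ 2 ℕ.* suc j → a ≢ b
  odd≢even i j refl refl eq =
    ℕₚ.even≢odd (suc j) i (trans (sym eq) (ℕₚ.+-suc i (i ℕ.+ 0)))

Γ : ∀ n → Graph (2 ℕ.* n)
Γ n = record
  { Edge        = λ v w → ∃₂ λ (i j : Fin n) → i Fin.≤ j × (Ends i j v w ⊎ Ends i j w v)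
  ; edge?       = λ v w → any? λ i → any? λ j → (i ≤ᶠ? j) ×-dec (ends? i j v w ⊎-dec ends? i j w v)
  ; edge-sym    = λ (i , j , i≤j , e) → i , j , i≤j , swap e
  ; edge-irrefl = λ where
      refl (i , j , _ , inj₁ (p , q)) → odd≢even (toℕ i) (toℕ j) p q refl
      refl (i , j , _ , inj₂ (p , q)) → odd≢even (toℕ i) (toℕ j) p q refl
  }
  where
    Ends : (i j : Fin n) (v w : Fin (2 ℕ.* n)) → Set
    Ends i j v w = label v ≡ 2 ℕ.* label i ∸ 1 × label w ≡ 2 ℕ.* label j

    ends? : ∀ i j v w → Dec (Ends i j v w)
    ends? i j v w = (label v ℕₚ.≟ 2 ℕ.* label i ∸ 1) ×-dec (label w ℕₚ.≟ 2 ℕ.* label j)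

module Submission where

-- Evaluation at all integers q ≥ 1 determines a polynomial over ℚ, so the coefficients may be compared at t = q.
--
-- A q-colouring is constant on the blocks of a bond π iff π refines the partition into monochromatic components, and
-- there are q ^ #blocks such colourings. As the rank of π is the number of vertices minus the number of blocks, Möbius
-- inversion shows that q χ(q) counts the proper q-colourings.
--
-- Colour Γ n in the order 1, 2, ..., 2n and let k be the number of colours met on odd vertices so far. The next odd
-- vertex and its successor can be coloured in k (q - k) ways if the odd one repeats an old colour and in
-- (q - k) (q - k - 1) ways otherwise. So q χ(q) is a weighted count of lattice paths; expanding it by the final value
-- of k gives the right-hand side, since staying at height k contributes the factor 1 / (1 - k (q - k) u).

-- The weights depend only on k because vertex 2j is adjacent to exactly the odd vertices coloured
-- before it. An odd vertex therefore meets no constraint when it is coloured, and an even one must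
-- avoid just the set of colours met so far on odd vertices, whose size is k.
--
-- The numerators come from the rising steps: the product of (q - k)(q - k - 1) over k < n is (q)_n
-- (q-1)_n = q (q-1)_{n-1} (q-1)_n, and the factor q cancels. At k = 0 no colour can be repeated, so
-- the first step always rises; the remaining path starts at height 1, which is why the denominators
-- begin with k = 1.
--
-- Two points need care. The rank is defined by longest chains, so its formula in terms of blocks
-- has to be proved, by exhibiting a grading. And the factor q in front of χ(q), which is there
-- because the length of the lattice is one less than the number of vertices, must be cancelled;
-- hence only q ≥ 1 is used.

open import Defs
import Algebra.Definitions.RawSemiring as RawSemiringDefs
open import Algebra.Bundles using (CommutativeRing)
open import Algebra.Bundles.Raw using (RawRing)
import Algebra.Properties.Semiring.Sum as SemiringSum
open import Data.Bool.Base using (Bool; true; false; if_then_else_; _∨_)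
open import Data.Bool.Properties using () renaming (_≟_ to _≟ᵇ_)
open import Data.Fin.Base as Fin using (Fin; zero; suc; toℕ; fromℕ)
open import Data.Fin.Properties as Finₚ using (all?; any?) renaming (_≟_ to _≟ᶠ_; _≤?_ to _≤ᶠ?_)
open import Data.Fin.Subset using (Subset; _∈_)
open import Data.Fin.Subset.Properties using (_∈?_)
open import Data.Integer.Base as ℤ using (ℤ; 0ℤ; 1ℤ)
import Data.Integer.Properties as ℤₚ
open import Data.Integer.Tactic.RingSolver using (solve-∀)
open import Data.List.Base as List using (List; []; _∷_; foldr; length)
import Data.List.Properties as Listₚ
open import Data.List.Relation.Unary.All as All using (All; []; _∷_)
open import Data.List.Relation.Unary.AllPairs using ([]; _∷_)
open import Data.List.Relation.Unary.Any as Any using (Any; here; there)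
open import Data.List.Relation.Unary.Unique.Setoid using (Unique)
open import Data.Nat.Base as ℕ using (ℕ; zero; suc; _⊔_; _∸_; z≤n; s≤s)
import Data.Nat.Properties as ℕₚ
open import Data.Product.Base using (_×_; _,_; ∃-syntax; ∃₂; proj₁; proj₂)
open import Data.Rational.Base as ℚ using (ℚ; 0ℚ; 1ℚ)
import Data.Rational.Properties as ℚₚ
open import Data.Rational.Solver using (module +-*-Solver)
import Data.Rational.Unnormalised.Base as ℚᵘ
import Data.Rational.Unnormalised.Properties as ℚᵘₚ
open import Data.Sum.Base using (_⊎_; inj₁; inj₂)
open import Data.Unit.Base using (⊤; tt)
open import Data.Vec.Base using (Vec; []; _∷_; lookup; tabulate)
import Data.Vec.Properties as Vecₚ
open import Function.Base using (_∘_; _on_)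
open import Induction.WellFounded using (Acc; acc)
open import Level using (0ℓ)
open import Relation.Binary.Bundles using (DecSetoid)
open import Relation.Binary.Construct.Closure.ReflexiveTransitive as Star using (Star; ε; _◅_; _◅◅_)
open import Relation.Binary.Core using (Rel)
import Relation.Binary.Definitions as B
open import Relation.Binary.PropositionalEquality using (_≡_; _≢_; _≗_; refl; sym; trans; cong; cong₂; subst; module ≡-Reasoning)
open import Relation.Binary.Structures using (IsEquivalence)
open import Relation.Nullary using (¬_; Dec; yes; no; contradiction)
open import Relation.Nullary.Decidable using (does; _×-dec_; _⊎-dec_; _→-dec_; ¬?; dec-true; decidable-stable)
open import Relation.Unary using (Pred; Decidable)

private module Σℤ = SemiringSum (CommutativeRing.semiring ℤₚ.+-*-commutativeRing)

-- Evaluation of polynomials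

module _ where
  open import Data.Rational.Base using (_+_; _*_; -_; _-_)
  open CommutativeRing ℚₚ.+-*-commutativeRing using (semiring; zeroˡ; zeroʳ)
  open SemiringSum semiring using (sum; sum-cong-≗; ∑-distrib-+; *-distribˡ-sum; sum-replicate-zero)
  open +-*-Solver using (solve; _:=_; _:+_; _:*_; :-_; con)

  Poly : Set
  Poly = RawRing.Carrier ℚ[t]

  module P = RingNotation ℚ[t]
  module Q = RingNotation ℚₚ.+-*-rawRing
  module PS = RingNotation ℚ[t]⟦u⟧
  open Polynomial ℚₚ.+-*-rawRing using (coeff)

  ℚ⟦u⟧ : RawRing _ _
  ℚ⟦u⟧ = PowerSeries.rawRing ℚₚ.+-*-rawRing

  module QS = RingNotation ℚ⟦u⟧
  module ℚS = PowerSeries ℚₚ.+-*-rawRing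

  eval : ℚ → Poly → ℚ
  eval x []      = 0ℚ
  eval x (a ∷ p) = a + x * eval x p

  module _ (x : ℚ) where

    eval-+ : ∀ p r → eval x (p P.+ r) ≡ eval x p + eval x r
    eval-+ []      r       = sym (ℚₚ.+-identityˡ _)
    eval-+ (a ∷ p) []      = sym (ℚₚ.+-identityʳ _)
    eval-+ (a ∷ p) (b ∷ r) = trans (cong (λ e → a + b + x * e) (eval-+ p r))
      (solve 5 (λ a b x p r → a :+ b :+ x :* (p :+ r) := a :+ x :* p :+ (b :+ x :* r)) refl a b x (eval x p) (eval x r))

    eval-scale : ∀ a p → eval x (List.map (a *_) p) ≡ a * eval x p
    eval-scale a []      = sym (zeroʳ a)
    eval-scale a (b ∷ p) = trans (cong (λ e → a * b + x * e) (eval-scale a p))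
      (solve 4 (λ a b x p → a :* b :+ x :* (a :* p) := a :* (b :+ x :* p)) refl a b x (eval x p))

    eval-* : ∀ p r → eval x (p P.* r) ≡ eval x p * eval x r
    eval-* []      r = sym (zeroˡ (eval x r))
    eval-* (a ∷ p) r = begin
      eval x (List.map (a *_) r P.+ (0ℚ ∷ p P.* r))            ≡⟨ eval-+ (List.map (a *_) r) _ ⟩
      eval x (List.map (a *_) r) + (0ℚ + x * eval x (p P.* r))
        ≡⟨ cong₂ (λ y z → y + (0ℚ + x * z)) (eval-scale a r) (eval-* p r) ⟩
      a * eval x r + (0ℚ + x * (eval x p * eval x r))
        ≡⟨ solve 4 (λ a x p r → a :* r :+ (con 0ℚ :+ x :* (p :* r)) := (a :+ x :* p) :* r) refl a x (eval x p) (eval x r) ⟩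
      (a + x * eval x p) * eval x r ∎
      where open ≡-Reasoning

    eval-neg : ∀ p → eval x (P.- p) ≡ - eval x p
    eval-neg []      = refl
    eval-neg (a ∷ p) = trans (cong (λ e → - a + x * e) (eval-neg p))
      (solve 3 (λ a x p → :- a :+ x :* (:- p) := :- (a :+ x :* p)) refl a x (eval x p))

    eval-const : ∀ a → eval x (constₜ a) ≡ a
    eval-const a = trans (cong (λ y → a + y) (zeroʳ x)) (ℚₚ.+-identityʳ a)

    eval-1 : eval x 1ₜ ≡ 1ℚ
    eval-1 = eval-const 1ℚ

    eval-t : eval x t ≡ x
    eval-t = solve 1 (λ x → con 0ℚ :+ x :* (con 1ℚ :+ x :* con 0ℚ) := x) refl x

    eval-− : ∀ p r → eval x (p P.- r) ≡ eval x p - eval x r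
    eval-− p r = trans (eval-+ p (P.- r)) (cong (eval x p +_) (eval-neg r))

    eval-^ : ∀ p n → eval x (p P.^ n) ≡ eval x p Q.^ n
    eval-^ p zero    = eval-1
    eval-^ p (suc n) = trans (eval-* p (p P.^ n)) (cong (eval x p *_) (eval-^ p n))

    eval-fromℕ : ∀ n → eval x (P.fromℕ n) ≡ Q.fromℕ n
    eval-fromℕ zero    = refl
    eval-fromℕ (suc n) = trans (eval-+ 1ₜ (P.fromℕ n)) (cong₂ _+_ eval-1 (eval-fromℕ n))

    eval-sum : ∀ {n} (f : Fin n → Poly) → eval x (RawSemiringDefs.sum P.rawSemiring f) ≡ sum (eval x ∘ f)
    eval-sum {zero}  f = refl
    eval-sum {suc n} f = trans (eval-+ (f zero) _) (cong (eval x (f zero) +_) (eval-sum (f ∘ suc)))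

    eval-product : ∀ {n} (f : Fin n → Poly) → eval x (P.product f) ≡ Q.product (eval x ∘ f)
    eval-product {zero}  f = eval-1
    eval-product {suc n} f = trans (eval-* (f zero) _) (cong (eval x (f zero) *_) (eval-product (f ∘ suc)))

  ℚ-product-cong : ∀ {n} {f g : Fin n → ℚ} → f ≗ g → Q.product f ≡ Q.product g
  ℚ-product-cong {zero}  f≗g = refl
  ℚ-product-cong {suc n} f≗g = cong₂ _*_ (f≗g zero) (ℚ-product-cong (f≗g ∘ suc))

  eval-falling : ∀ x p n → eval x (fallingₜ p n) ≡ Q.falling (eval x p) n
  eval-falling x p n = trans (eval-product x (λ (i : Fin n) → p P.- P.fromℕ (toℕ i)))
    (ℚ-product-cong {n} λ i → trans (eval-− x p (P.fromℕ (toℕ i))) (cong (λ e → eval x p - e) (eval-fromℕ x (toℕ i))))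

  -- Polynomials with infinitely many zeros

  coeff-+ : ∀ p r i → coeff (p P.+ r) i ≡ coeff p i + coeff r i
  coeff-+ []      r       i       = sym (ℚₚ.+-identityˡ _)
  coeff-+ (a ∷ p) []      i       = sym (ℚₚ.+-identityʳ _)
  coeff-+ (a ∷ p) (b ∷ r) zero    = refl
  coeff-+ (a ∷ p) (b ∷ r) (suc i) = coeff-+ p r i

  coeff-map : ∀ {f : ℚ → ℚ} → f 0ℚ ≡ 0ℚ → ∀ p i → coeff (List.map f p) i ≡ f (coeff p i)
  coeff-map f0 []      i       = sym f0
  coeff-map f0 (a ∷ p) zero    = refl
  coeff-map f0 (a ∷ p) (suc i) = coeff-map f0 p i

  length-+ : ∀ {d} p r → length p ℕ.≤ d → length r ℕ.≤ d → length (p P.+ r) ℕ.≤ d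
  length-+ []      r       p≤ r≤             = r≤
  length-+ (a ∷ p) []      p≤ r≤             = p≤
  length-+ (a ∷ p) (b ∷ r) (s≤s p≤) (s≤s r≤) = s≤s (length-+ p r p≤ r≤)

  module _ (c : ℚ) where

    -- The quotient of p by t - c.
    quot : Poly → Poly
    quot []      = []
    quot (a ∷ p) = p P.+ List.map (c *_) (quot p)

    -- If p = p(c) + (t - c) s, then a + t p = (a + c p(c)) + (t - c)(p + c s), which explains the
    -- recursion of `quot`.
    eval-quot : ∀ x p → eval x p ≡ eval c p + (x - c) * eval x (quot p)
    eval-quot x []      = sym (trans (cong (0ℚ +_) (zeroʳ (x - c))) refl)
    eval-quot x (a ∷ p) = begin
      a + x * eval x p
        ≡⟨ cong (λ e → a + x * e) (eval-quot x p) ⟩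
      a + x * (eval c p + (x - c) * s)
        ≡⟨ solve 5 (λ a x c p s → a :+ x :* (p :+ (x :+ :- c) :* s)
                     := a :+ c :* p :+ (x :+ :- c) :* (p :+ (x :+ :- c) :* s :+ c :* s)) refl a x c (eval c p) s ⟩
      a + c * eval c p + (x - c) * (eval c p + (x - c) * s + c * s)
        ≡⟨ cong (λ e → a + c * eval c p + (x - c) * (e + c * s)) (eval-quot x p) ⟨
      a + c * eval c p + (x - c) * (eval x p + c * s)
        ≡⟨ cong (λ e → a + c * eval c p + (x - c) * (eval x p + e)) (eval-scale x c (quot p)) ⟨
      a + c * eval c p + (x - c) * (eval x p + eval x (List.map (c *_) (quot p)))
        ≡⟨ cong (λ e → a + c * eval c p + (x - c) * e) (eval-+ x p _) ⟨
      a + c * eval c p + (x - c) * eval x (quot (a ∷ p)) ∎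
      where
      open ≡-Reasoning
      s = eval x (quot p)

    -- Division by a linear factor lowers the length bound by one; this is what lets
    -- `vanishing⇒zero` recurse.
    length-quot : ∀ {d} a p → length p ℕ.≤ d → length (quot (a ∷ p)) ℕ.≤ d
    length-quot a []      p≤       = p≤
    length-quot a (b ∷ p) (s≤s p≤) = length-+ (b ∷ p) (List.map (c *_) (quot (b ∷ p))) (s≤s p≤)
      (subst (ℕ._≤ _) (sym (Listₚ.length-map (c *_) (quot (b ∷ p)))) (length-quot b p (ℕₚ.m≤n⇒m≤1+n p≤)))

    coeff-quot : ∀ a p i → coeff (quot (a ∷ p)) i ≡ coeff p i + c * coeff (quot p) i
    coeff-quot a p i = trans (coeff-+ p _ i) (cong (coeff p i +_) (coeff-map (zeroʳ c) (quot p) i))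

    -- Synthetic division runs from the leading coefficient downwards, so a new constant term leaves
    -- the old quotient intact in the higher places.
    coeff-quot-suc : ∀ a p i → coeff (quot (a ∷ p)) (suc i) ≡ coeff (quot p) i
    coeff-quot-suc a []      i = refl
    coeff-quot-suc a (b ∷ p) i = begin
      coeff (quot (a ∷ b ∷ p)) (suc i)            ≡⟨ coeff-quot a (b ∷ p) (suc i) ⟩
      coeff p i + c * coeff (quot (b ∷ p)) (suc i) ≡⟨ cong (λ e → coeff p i + c * e) (coeff-quot-suc b p i) ⟩
      coeff p i + c * coeff (quot p) i             ≡⟨ coeff-quot b p i ⟨
      coeff (quot (b ∷ p)) i                       ∎
      where open ≡-Reasoning

    -- Each coefficient of p is a combination of two neighbouring coefficients of the quotient of a
    -- + t p.
    quot-zero : ∀ a p → (∀ i → coeff (quot (a ∷ p)) i ≡ 0ℚ) → ∀ i → coeff p i ≡ 0ℚ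
    quot-zero a p s≈0 i = begin
      coeff p i                           ≡⟨ solve 2 (λ x y → x := x :+ y :* con 0ℚ) refl (coeff p i) c ⟩
      coeff p i + c * 0ℚ
        ≡⟨ cong (λ e → coeff p i + c * e) (trans (sym (s≈0 (suc i))) (coeff-quot-suc a p i)) ⟩
      coeff p i + c * coeff (quot p) i    ≡⟨ coeff-quot a p i ⟨
      coeff (quot (a ∷ p)) i              ≡⟨ s≈0 i ⟩
      0ℚ                                  ∎
      where open ≡-Reasoning

  eval-zero : ∀ x p → (∀ i → coeff p i ≡ 0ℚ) → eval x p ≡ 0ℚ
  eval-zero x []      p≈0 = refl
  eval-zero x (a ∷ p) p≈0 = trans (cong₂ (λ a e → a + x * e) (p≈0 zero) (eval-zero x p (p≈0 ∘ suc))) (cong (0ℚ +_) (zeroʳ x))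

  -- The integers inside the rationals

  ι : ℤ → ℚ
  ι z = z ℚ./ 1

  -- `ι` reduces fractions by a gcd and does not compute on a variable, so its laws are carried over
  -- from the unnormalised fractions z / 1.
  toℚᵘ-ι : ∀ z → ℚ.toℚᵘ (ι z) ℚᵘ.≃ ℚᵘ.mkℚᵘ z 0
  toℚᵘ-ι z = ℚₚ.toℚᵘ-fromℚᵘ (ℚᵘ.mkℚᵘ z 0)

  ι-+ : ∀ a b → ι (a ℤ.+ b) ≡ ι a + ι b
  ι-+ a b = ℚₚ.toℚᵘ-injective (begin-equality
    ℚ.toℚᵘ (ι (a ℤ.+ b))              ≃⟨ toℚᵘ-ι (a ℤ.+ b) ⟩
    ℚᵘ.mkℚᵘ (a ℤ.+ b) 0
      ≃⟨ ℚᵘ.*≡* (cong (ℤ._* ℤ.+ 1) (sym (cong₂ ℤ._+_ (ℤₚ.*-identityʳ a) (ℤₚ.*-identityʳ b)))) ⟩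
    ℚᵘ.mkℚᵘ a 0 ℚᵘ.+ ℚᵘ.mkℚᵘ b 0      ≃⟨ ℚᵘₚ.+-cong (toℚᵘ-ι a) (toℚᵘ-ι b) ⟨
    ℚ.toℚᵘ (ι a) ℚᵘ.+ ℚ.toℚᵘ (ι b)    ≃⟨ ℚₚ.toℚᵘ-homo-+ (ι a) (ι b) ⟨
    ℚ.toℚᵘ (ι a + ι b)                ∎)
    where open ℚᵘₚ.≤-Reasoning

  ι-* : ∀ a b → ι (a ℤ.* b) ≡ ι a * ι b
  ι-* a b = ℚₚ.toℚᵘ-injective (begin-equality
    ℚ.toℚᵘ (ι (a ℤ.* b))              ≃⟨ toℚᵘ-ι (a ℤ.* b) ⟩
    ℚᵘ.mkℚᵘ (a ℤ.* b) 0               ≃⟨ ℚᵘ.*≡* refl ⟩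
    ℚᵘ.mkℚᵘ a 0 ℚᵘ.* ℚᵘ.mkℚᵘ b 0      ≃⟨ ℚᵘₚ.*-cong (toℚᵘ-ι a) (toℚᵘ-ι b) ⟨
    ℚ.toℚᵘ (ι a) ℚᵘ.* ℚ.toℚᵘ (ι b)    ≃⟨ ℚₚ.toℚᵘ-homo-* (ι a) (ι b) ⟨
    ℚ.toℚᵘ (ι a * ι b)                ∎)
    where open ℚᵘₚ.≤-Reasoning

  ι-neg : ∀ a → ι (ℤ.- a) ≡ - ι a
  ι-neg a = begin
    ι (ℤ.- a)                   ≡⟨ solve 2 (λ x y → y := :- x :+ (x :+ y)) refl (ι a) (ι (ℤ.- a)) ⟩
    - ι a + (ι a + ι (ℤ.- a))   ≡⟨ cong (- ι a +_) (ι-+ a (ℤ.- a)) ⟨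
    - ι a + ι (a ℤ.+ ℤ.- a)     ≡⟨ cong (λ z → - ι a + ι z) (ℤₚ.+-inverseʳ a) ⟩
    - ι a + 0ℚ                  ≡⟨ ℚₚ.+-identityʳ (- ι a) ⟩
    - ι a                       ∎
    where open ≡-Reasoning

  ι-injective : ∀ {a b} → ι a ≡ ι b → a ≡ b
  ι-injective {a} {b} eq with ℚᵘₚ.≃-trans (ℚᵘₚ.≃-sym (toℚᵘ-ι a)) (ℚᵘₚ.≃-trans (ℚᵘₚ.≃-reflexive (cong ℚ.toℚᵘ eq)) (toℚᵘ-ι b))
  ... | ℚᵘ.*≡* e = trans (sym (ℤₚ.*-identityʳ a)) (trans e (ℤₚ.*-identityʳ b))

  fromℕ≡ι : ∀ n → Q.fromℕ n ≡ ι (ℤ.+ n)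
  fromℕ≡ι zero    = refl
  fromℕ≡ι (suc n) = trans (cong (1ℚ +_) (fromℕ≡ι n)) (sym (ι-+ (ℤ.+ 1) (ℤ.+ n)))

  *-cancelˡ-≢0 : ∀ x {y z} → x ≢ 0ℚ → x * y ≡ x * z → y ≡ z
  *-cancelˡ-≢0 x {y} {z} x≢0 eq = begin
    y                   ≡⟨ inv y ⟨
    ℚ.1/ x * (x * y)    ≡⟨ cong (ℚ.1/ x *_) eq ⟩
    ℚ.1/ x * (x * z)    ≡⟨ inv z ⟩
    z                   ∎
    where
    open ≡-Reasoning
    instance _ = ℚ.≢-nonZero x≢0
    inv : ∀ w → ℚ.1/ x * (x * w) ≡ w
    inv w = trans (sym (ℚₚ.*-assoc (ℚ.1/ x) x w)) (trans (cong (_* w) (ℚₚ.*-inverseˡ x)) (ℚₚ.*-identityˡ w))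

  -- Induction on the length bound: N is a zero, so p = (t - N) s, and s vanishes at every k > N
  -- because k - N is not 0. Raising the threshold by one for each division replaces a count of
  -- distinct zeros.
  vanishing⇒zero : ∀ {d} p → length p ℕ.≤ d → ∀ N → (∀ k → N ℕ.≤ k → eval (ι (ℤ.+ k)) p ≡ 0ℚ) → ∀ i → coeff p i ≡ 0ℚ
  vanishing⇒zero []      _        N p0 i = refl
  vanishing⇒zero {suc d} (a ∷ p) (s≤s p≤) N p0 = λ { zero → a≡0 ; (suc i) → p≈0 i }
    where
    open ≡-Reasoning
    c = ι (ℤ.+ N)

    nonzero : ∀ {k} → N ℕ.< k → ι (ℤ.+ k) - c ≢ 0ℚ
    nonzero {k} N<k eq = ℕₚ.<⇒≢ N<k (ℤₚ.+-injective (sym (ι-injective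
      (trans (solve 2 (λ x y → x := (x :+ :- y) :+ y) refl (ι (ℤ.+ k)) c) (trans (cong (_+ c) eq) (ℚₚ.+-identityˡ c))))))

    quot0 : ∀ k → N ℕ.< k → eval (ι (ℤ.+ k)) (quot c (a ∷ p)) ≡ 0ℚ
    quot0 k N<k = *-cancelˡ-≢0 (ι (ℤ.+ k) - c) (nonzero N<k) (begin
      (x - c) * s                          ≡⟨ solve 2 (λ e s → s := :- e :+ (e :+ s)) refl e₀ ((x - c) * s) ⟩
      - e₀ + (e₀ + (x - c) * s)            ≡⟨ cong (- e₀ +_) (eval-quot c x (a ∷ p)) ⟨
      - e₀ + eval x (a ∷ p)                ≡⟨ cong₂ (λ y z → - y + z) (p0 N ℕₚ.≤-refl) (p0 k (ℕₚ.<⇒≤ N<k)) ⟩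
      0ℚ                                   ≡⟨ zeroʳ (x - c) ⟨
      (x - c) * 0ℚ                         ∎)
      where
      x = ι (ℤ.+ k)
      s = eval x (quot c (a ∷ p))
      e₀ = eval c (a ∷ p)

    p≈0 : ∀ i → coeff p i ≡ 0ℚ
    p≈0 = quot-zero c a p (vanishing⇒zero (quot c (a ∷ p)) (length-quot c a p p≤) (suc N) quot0)

    a≡0 : a ≡ 0ℚ
    a≡0 = begin
      a                ≡⟨ solve 2 (λ a c → a := a :+ c :* con 0ℚ) refl a c ⟩
      a + c * 0ℚ       ≡⟨ cong (λ e → a + c * e) (eval-zero c p p≈0) ⟨
      eval c (a ∷ p)   ≡⟨ p0 N ℕₚ.≤-refl ⟩
      0ℚ               ∎

  -- The sample points start at 1 because the colouring counts give q times a value, which says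
  -- nothing at q = 0.
  eval-injective : ∀ {p r} → (∀ k → eval (ι (ℤ.+ suc k)) p ≡ eval (ι (ℤ.+ suc k)) r) → p P.≈ r
  eval-injective {p} {r} eq i = begin
    coeff p i
      ≡⟨ solve 2 (λ x y → x := (x :+ :- y) :+ y) refl (coeff p i) (coeff r i) ⟩
    (coeff p i - coeff r i) + coeff r i            ≡⟨ cong (λ e → (coeff p i + e) + coeff r i) (coeff-map refl r i) ⟨
    (coeff p i + coeff (P.- r) i) + coeff r i      ≡⟨ cong (_+ coeff r i) (coeff-+ p (P.- r) i) ⟨
    coeff (p P.- r) i + coeff r i
      ≡⟨ cong (_+ coeff r i) (vanishing⇒zero (p P.- r) ℕₚ.≤-refl 1 diff0 i) ⟩
    0ℚ + coeff r i                                 ≡⟨ ℚₚ.+-identityˡ _ ⟩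
    coeff r i                                      ∎
    where
    open ≡-Reasoning
    diff0 : ∀ k → 1 ℕ.≤ k → eval (ι (ℤ.+ k)) (p P.- r) ≡ 0ℚ
    diff0 (suc k) _ = trans (eval-− x p r) (trans (cong (_- eval x r) (eq k)) (ℚₚ.+-inverseʳ (eval x r)))
      where x = ι (ℤ.+ suc k)

  -- Power series over ℚ

  Seriesℚ : Set
  Seriesℚ = ℕ → ℚ

  sum-zero : ∀ {n} {f : Fin n → ℚ} → (∀ i → f i ≡ 0ℚ) → sum f ≡ 0ℚ
  sum-zero {n} f≗0 = trans (sum-cong-≗ f≗0) (sum-replicate-zero n)

  conv-cong : ∀ {f f′ g g′ : Seriesℚ} → f ≗ f′ → g ≗ g′ → f QS.* g ≗ f′ QS.* g′
  conv-cong f≗ g≗ m = sum-cong-≗ {suc m} λ i → cong₂ _*_ (f≗ (toℕ i)) (g≗ (m ∸ toℕ i))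

  module _ (f g h : Seriesℚ) where

    conv-+ˡ : ∀ m → ((λ k → f k + g k) QS.* h) m ≡ (f QS.* h) m + (g QS.* h) m
    conv-+ˡ m = trans
      (sum-cong-≗ {suc m} λ i → ℚₚ.*-distribʳ-+ (h (m ∸ toℕ i)) (f (toℕ i)) (g (toℕ i)))
      (∑-distrib-+ {suc m} (λ i → f (toℕ i) * h (m ∸ toℕ i)) λ i → g (toℕ i) * h (m ∸ toℕ i))

    conv-+ʳ : ∀ m → (f QS.* (λ k → g k + h k)) m ≡ (f QS.* g) m + (f QS.* h) m
    conv-+ʳ m = trans
      (sum-cong-≗ {suc m} λ i → ℚₚ.*-distribˡ-+ (f (toℕ i)) (g (m ∸ toℕ i)) (h (m ∸ toℕ i)))
      (∑-distrib-+ {suc m} (λ i → f (toℕ i) * g (m ∸ toℕ i)) λ i → f (toℕ i) * h (m ∸ toℕ i))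

  module _ (a : ℚ) (f g : Seriesℚ) where

    conv-scaleˡ : ∀ m → ((λ k → a * f k) QS.* g) m ≡ a * (f QS.* g) m
    conv-scaleˡ m = trans
      (sum-cong-≗ {suc m} λ i → ℚₚ.*-assoc a (f (toℕ i)) (g (m ∸ toℕ i)))
      (sym (*-distribˡ-sum {suc m} a λ i → f (toℕ i) * g (m ∸ toℕ i)))

    conv-scaleʳ : ∀ m → (f QS.* (λ k → a * g k)) m ≡ a * (f QS.* g) m
    conv-scaleʳ m = trans
      (sum-cong-≗ {suc m} λ i → solve 3 (λ a x y → x :* (a :* y) := a :* (x :* y)) refl a (f (toℕ i)) (g (m ∸ toℕ i)))
      (sym (*-distribˡ-sum {suc m} a λ i → f (toℕ i) * g (m ∸ toℕ i)))

  shift : Seriesℚ → Seriesℚ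
  shift f zero    = 0ℚ
  shift f (suc m) = f m

  shift-cong : ∀ {f g} → f ≗ g → shift f ≗ shift g
  shift-cong f≗g zero    = refl
  shift-cong f≗g (suc m) = f≗g m

  shift^ : ℕ → Seriesℚ → Seriesℚ
  shift^ zero    f = f
  shift^ (suc n) f = shift (shift^ n f)

  shift^-cong : ∀ n {f g} → f ≗ g → shift^ n f ≗ shift^ n g
  shift^-cong zero    f≗g = f≗g
  shift^-cong (suc n) f≗g = shift-cong (shift^-cong n f≗g)

  const-conv : ∀ a f m → (ℚS.const a QS.* f) m ≡ a * f m
  const-conv a f zero    = ℚₚ.+-identityʳ (a * f 0)
  const-conv a f (suc m) = trans
    (cong (a * f (suc m) +_) (sum-zero {suc m} λ i → zeroˡ (f (m ∸ toℕ i))))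
    (ℚₚ.+-identityʳ (a * f (suc m)))

  1-conv : ∀ f m → (QS.1# QS.* f) m ≡ f m
  1-conv f m = trans (const-conv 1ℚ f m) (ℚₚ.*-identityˡ (f m))

  shift-conv : ∀ f g m → (shift f QS.* g) m ≡ shift (f QS.* g) m
  shift-conv f g zero    = trans (ℚₚ.+-identityʳ (0ℚ * g 0)) (zeroˡ (g 0))
  shift-conv f g (suc m) = trans (cong (_+ (f QS.* g) m) (zeroˡ (g (suc m)))) (ℚₚ.+-identityˡ _)

  conv-shift : ∀ f g m → (f QS.* shift g) m ≡ shift (f QS.* g) m
  conv-shift f g zero          = trans (ℚₚ.+-identityʳ (f 0 * 0ℚ)) (zeroʳ (f 0))
  conv-shift f g (suc zero)    = cong (f 0 * g 0 +_) (conv-shift (f ∘ suc) g zero)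
  conv-shift f g (suc (suc m)) = cong (f 0 * g (suc m) +_) (conv-shift (f ∘ suc) g (suc m))

  var≗shift1 : ℚS.var ≗ shift QS.1#
  var≗shift1 zero          = refl
  var≗shift1 (suc zero)    = refl
  var≗shift1 (suc (suc m)) = refl

  var-conv : ∀ f → ℚS.var QS.* f ≗ shift f
  var-conv f m = begin
    (ℚS.var QS.* f) m      ≡⟨ conv-cong {g = f} var≗shift1 (λ _ → refl) m ⟩
    (shift QS.1# QS.* f) m ≡⟨ shift-conv QS.1# f m ⟩
    shift (QS.1# QS.* f) m ≡⟨ shift-cong (1-conv f) m ⟩
    shift f m              ∎
    where open ≡-Reasoning

  monomial-conv : ∀ a n g → (ℚS.const a QS.* (ℚS.var QS.^ n)) QS.* g ≗ λ m → a * shift^ n g m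
  monomial-conv a n g m = begin
    ((ℚS.const a QS.* (ℚS.var QS.^ n)) QS.* g) m    ≡⟨ conv-cong {g = g} (const-conv a (ℚS.var QS.^ n)) (λ _ → refl) m ⟩
    ((λ k → a * (ℚS.var QS.^ n) k) QS.* g) m        ≡⟨ conv-scaleˡ a (ℚS.var QS.^ n) g m ⟩
    a * ((ℚS.var QS.^ n) QS.* g) m                  ≡⟨ cong (a *_) (power n m) ⟩
    a * shift^ n g m                                ∎
    where
    open ≡-Reasoning
    power : ∀ n → (ℚS.var QS.^ n) QS.* g ≗ shift^ n g
    power zero    m = 1-conv g m
    power (suc n) m = begin
      ((ℚS.var QS.* (ℚS.var QS.^ n)) QS.* g) m    ≡⟨ conv-cong {g = g} (var-conv (ℚS.var QS.^ n)) (λ _ → refl) m ⟩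
      (shift (ℚS.var QS.^ n) QS.* g) m            ≡⟨ shift-conv (ℚS.var QS.^ n) g m ⟩
      shift ((ℚS.var QS.^ n) QS.* g) m            ≡⟨ shift-cong (power n) m ⟩
      shift (shift^ n g) m                        ∎

  module _ (g : Seriesℚ) (g₀ : g 0 ≡ 1ℚ) where

    -- Comparing coefficients in g * k = 1 forces on k the recursion that defines the inverse.
    inverse-unique : ∀ k → g QS.* k ≗ QS.1# → ℚS.inverse g ≗ k
    inverse-unique k gk≗1 m = trans (lookup₀ m) (coeffs m zero)
      where
      open ≡-Reasoning
      lookup₀ : ∀ m → ℚS.inverse g m ≡ lookup (ℚS.inverseCoeffs g m) zero
      lookup₀ zero    = refl
      lookup₀ (suc m) = refl

      solve-for : ∀ m s → (g QS.* k) m ≡ g 0 * k m + s → k m ≡ QS.1# m - s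
      solve-for m s eq = begin
        k m                      ≡⟨ solve 2 (λ x s → x := con 1ℚ :* x :+ s :+ :- s) refl (k m) s ⟩
        1ℚ * k m + s - s         ≡⟨ cong (λ a → a * k m + s - s) g₀ ⟨
        g 0 * k m + s - s        ≡⟨ cong (_- s) (trans (sym eq) (gk≗1 m)) ⟩
        QS.1# m - s              ∎

      coeffs : ∀ m i → lookup (ℚS.inverseCoeffs g m) i ≡ k (m ∸ toℕ i)
      coeffs zero    zero    = sym (solve-for 0 0ℚ refl)
      coeffs (suc m) (suc i) = coeffs m i
      coeffs (suc m) zero    = begin
        - sum {suc m} (λ i → g (suc (toℕ i)) * lookup (ℚS.inverseCoeffs g m) i)
          ≡⟨ cong -_ (sum-cong-≗ {suc m} λ i → cong (g (suc (toℕ i)) *_) (coeffs m i)) ⟩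
        - ((g ∘ suc) QS.* k) m
          ≡⟨ ℚₚ.+-identityˡ _ ⟨
        0ℚ - ((g ∘ suc) QS.* k) m
          ≡⟨ solve-for (suc m) _ refl ⟨
        k (suc m) ∎

    conv-inverse : g QS.* ℚS.inverse g ≗ QS.1#
    conv-inverse zero    = trans (cong (λ a → a * 1ℚ + 0ℚ) g₀) refl
    conv-inverse (suc m) = begin
      g 0 * - S + ((g ∘ suc) QS.* ℚS.inverse g) m
        ≡⟨ cong₂ (λ a b → a * - S + b) g₀ (sum-cong-≗ {suc m} λ i → cong (g (suc (toℕ i)) *_) (sym (coeffs m i))) ⟩
      1ℚ * - S + S                                    ≡⟨ solve 1 (λ s → con 1ℚ :* (:- s) :+ s := con 0ℚ) refl S ⟩
      0ℚ                                              ∎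
      where
      open ≡-Reasoning
      coeffs : ∀ m i → lookup (ℚS.inverseCoeffs g m) i ≡ ℚS.inverse g (m ∸ toℕ i)
      coeffs zero    zero    = refl
      coeffs (suc m) zero    = refl
      coeffs (suc m) (suc i) = coeffs m i

      S = sum {suc m} λ i → g (suc (toℕ i)) * lookup (ℚS.inverseCoeffs g m) i

  -- Inverses of products of linear factors

  linear : ℚ → Seriesℚ
  linear a = QS.1# QS.- (ℚS.const a QS.* ℚS.var)

  linear-conv : ∀ a f m → (linear a QS.* f) m ≡ f m - a * shift f m
  linear-conv a f m = begin
    (linear a QS.* f) m
      ≡⟨ conv-cong {g = f} (λ k → cong (λ e → QS.1# k + e) (neg k)) (λ _ → refl) m ⟩
    ((λ k → QS.1# k + - a * ℚS.var k) QS.* f) m     ≡⟨ conv-+ˡ QS.1# (λ k → - a * ℚS.var k) f m ⟩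
    (QS.1# QS.* f) m + ((λ k → - a * ℚS.var k) QS.* f) m
      ≡⟨ cong₂ _+_ (1-conv f m) (trans (conv-scaleˡ (- a) ℚS.var f m) (cong (- a *_) (var-conv f m))) ⟩
    f m + - a * shift f m                           ≡⟨ cong (f m +_) (ℚₚ.neg-distribˡ-* a (shift f m)) ⟨
    f m - a * shift f m                             ∎
    where
    open ≡-Reasoning
    neg : ∀ k → - (ℚS.const a QS.* ℚS.var) k ≡ - a * ℚS.var k
    neg k = trans (cong -_ (const-conv a ℚS.var k)) (ℚₚ.neg-distribˡ-* a (ℚS.var k))

  linears : (ℕ → ℚ) → ℕ → Seriesℚ
  linears X n = QS.product {n} λ i → linear (X (toℕ i))

  linears₀ : ∀ X n → linears X n 0 ≡ 1ℚ
  linears₀ X zero    = refl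
  linears₀ X (suc n) = begin
    (linear (X 0) QS.* linears (X ∘ suc) n) 0    ≡⟨ linear-conv (X 0) (linears (X ∘ suc) n) 0 ⟩
    linears (X ∘ suc) n 0 - X 0 * 0ℚ             ≡⟨ cong₂ (λ a b → a - b) (linears₀ (X ∘ suc) n) (zeroʳ (X 0)) ⟩
    1ℚ                                           ∎
    where open ≡-Reasoning

  1/linears : (ℕ → ℚ) → ℕ → Seriesℚ
  1/linears X n = ℚS.inverse (linears X n)

  -- Multiplying H = 1 / ((1 - X₀ u) D) by 1 - X₀ u leaves 1 / D; coefficientwise this reads H = X₀
  -- u H + 1 / D. The proof identifies (1 - X₀ u) H with the inverse of D by uniqueness.
  1/linears-rec : ∀ X n m → 1/linears X (suc n) m ≡ X 0 * shift (1/linears X (suc n)) m + 1/linears (X ∘ suc) n m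
  1/linears-rec X n m = begin
    H m                                   ≡⟨ solve 2 (λ x y → x := y :+ (x :+ :- y)) refl (H m) (a * shift H m) ⟩
    a * shift H m + (H m - a * shift H m)
      ≡⟨ cong (a * shift H m +_) (inverse-unique D (linears₀ (X ∘ suc) n) k Dk≗1 m) ⟨
    a * shift H m + 1/linears (X ∘ suc) n m       ∎
    where
    open ≡-Reasoning
    a = X 0
    D = linears (X ∘ suc) n
    H = 1/linears X (suc n)
    k : Seriesℚ
    k m = H m - a * shift H m

    -- The factor 1 - a u moves from H to D by additivity together with the fact that scaling and
    -- `shift` can be applied to either factor of a product.
    Dk≗1 : D QS.* k ≗ QS.1#
    Dk≗1 m = begin
      (D QS.* k) m
        ≡⟨ conv-cong {f = D} (λ _ → refl) (λ j → cong (H j +_) (ℚₚ.neg-distribˡ-* a (shift H j))) m ⟩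
      (D QS.* (λ j → H j + - a * shift H j)) m
        ≡⟨ conv-+ʳ D H (λ j → - a * shift H j) m ⟩
      (D QS.* H) m + (D QS.* (λ j → - a * shift H j)) m
        ≡⟨ cong ((D QS.* H) m +_) (trans (conv-scaleʳ (- a) D (shift H) m) (cong (- a *_) (conv-shift D H m))) ⟩
      (D QS.* H) m + - a * shift (D QS.* H) m
        ≡⟨ cong ((D QS.* H) m +_) (trans (conv-scaleˡ (- a) (shift D) H m) (cong (- a *_) (shift-conv D H m))) ⟨
      (D QS.* H) m + ((λ j → - a * shift D j) QS.* H) m
        ≡⟨ conv-+ˡ D (λ j → - a * shift D j) H m ⟨
      ((λ j → D j + - a * shift D j) QS.* H) m
        ≡⟨ conv-cong {g = H} (λ j → trans (cong (D j +_) (sym (ℚₚ.neg-distribˡ-* a (shift D j))))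
             (sym (linear-conv a D j))) (λ _ → refl) m ⟩
      (linears X (suc n) QS.* H) m
        ≡⟨ conv-inverse (linears X (suc n)) (linears₀ X (suc n)) m ⟩
      QS.1# m ∎

  1/linears₀ : ∀ X → 1/linears X 0 ≗ QS.1#
  1/linears₀ X = inverse-unique QS.1# refl QS.1# (1-conv QS.1#)

  -- The series uⁱ / ((1 - X₀ u) ... (1 - Xᵢ u)).
  τ : (ℕ → ℚ) → ℕ → Seriesℚ
  τ X i = shift^ i (1/linears X (suc i))

  shift^-rec : ∀ n a {f g} → (∀ m → f m ≡ a * shift f m + g m) →
               ∀ m → shift^ n f m ≡ a * shift (shift^ n f) m + shift^ n g m
  shift^-rec zero    a eq         = eq
  shift^-rec (suc n) a eq zero    = sym (cong (_+ 0ℚ) (zeroʳ a))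
  shift^-rec (suc n) a eq (suc m) = shift^-rec n a eq m

  τ-rec₀ : ∀ X m → τ X 0 (suc m) ≡ X 0 * τ X 0 m
  τ-rec₀ X m = trans (1/linears-rec X 0 (suc m))
    (trans (cong (X 0 * 1/linears X 1 m +_) (1/linears₀ (X ∘ suc) (suc m))) (ℚₚ.+-identityʳ _))

  -- `τ X i m` is the total weight of the paths of length m from height 0 to height i when rising
  -- steps weigh 1. The first step is either flat at height 0 or rises, after which the weights are
  -- shifted.
  τ-rec : ∀ X i m → τ X (suc i) (suc m) ≡ X 0 * τ X (suc i) m + τ (X ∘ suc) i m
  τ-rec X i m = shift^-rec (suc i) (X 0) (1/linears-rec X (suc i)) (suc m)

  -- The total weight of the lattice paths of length n in which a flat step at height k weighs X k and a rising one Y k.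
  Φ : (X Y : ℕ → ℚ) → ℕ → ℚ
  Φ X Y zero    = 1ℚ
  Φ X Y (suc n) = X 0 * Φ X Y n + Y 0 * Φ (X ∘ suc) (Y ∘ suc) n

  ∏ : (ℕ → ℚ) → ℕ → ℚ
  ∏ Y i = Q.product {i} λ k → Y (toℕ k)

  -- Paths are sorted by their final height i: each rises exactly once from every height below i,
  -- which contributes `∏ Y i`, and the flat steps contribute `τ X i m`. Length m bounds the height,
  -- so any N > m is enough.
  Φ-sum : ∀ X Y m {N} → m ℕ.< N → Φ X Y m ≡ sum {N} λ i → ∏ Y (toℕ i) * τ X (toℕ i) m
  Φ-sum X Y zero {suc N} _ = sym (cong (1ℚ +_) (sum-zero {N} λ i → zeroʳ (∏ Y (suc (toℕ i)))))
  Φ-sum X Y (suc m) {suc N} (s≤s m<N) = sym (begin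
    -- Final height 0 is split off: such a path never rises, so only the flat first step occurs in
    -- its recursion.
    1ℚ * τ X 0 (suc m) + sum {N} (λ i → ∏ Y (suc (toℕ i)) * τ X (suc (toℕ i)) (suc m))
      ≡⟨ cong₂ (λ a b → 1ℚ * a + b) (τ-rec₀ X m) (sum-cong-≗ {N} λ i → trans
           (cong (∏ Y (suc (toℕ i)) *_) (τ-rec X (toℕ i) m))
           (solve 5 (λ y p x a b → (y :* p) :* (x :* a :+ b) := x :* (y :* p :* a) :+ y :* (p :* b)) refl
             y₀ (∏ Y⁺ (toℕ i)) x₀ (τ X (suc (toℕ i)) m) (τ X⁺ (toℕ i) m))) ⟩
    1ℚ * (x₀ * τ X 0 m) + sum {N} (λ i → x₀ * A i + y₀ * B i)
      ≡⟨ cong (1ℚ * (x₀ * τ X 0 m) +_) (trans (∑-distrib-+ {N} (λ i → x₀ * A i) (λ i → y₀ * B i))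
           (sym (cong₂ _+_ (*-distribˡ-sum {N} x₀ A) (*-distribˡ-sum {N} y₀ B)))) ⟩
    1ℚ * (x₀ * τ X 0 m) + (x₀ * sum A + y₀ * sum B)
      ≡⟨ solve 5 (λ x t a y b → con 1ℚ :* (x :* t) :+ (x :* a :+ y :* b) := x :* (con 1ℚ :* t :+ a) :+ y :* b) refl
           x₀ (τ X 0 m) (sum A) y₀ (sum B) ⟩
    x₀ * sum {suc N} (λ i → ∏ Y (toℕ i) * τ X (toℕ i) m) + y₀ * sum B
      ≡⟨ cong₂ (λ a b → x₀ * a + y₀ * b) (Φ-sum X Y m (ℕₚ.m≤n⇒m≤1+n m<N)) (Φ-sum X⁺ Y⁺ m m<N) ⟨
    x₀ * Φ X Y m + y₀ * Φ X⁺ Y⁺ m ∎)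
    where
    open ≡-Reasoning
    x₀ = X 0
    y₀ = Y 0
    X⁺ = X ∘ suc
    Y⁺ = Y ∘ suc
    A B : Fin N → ℚ
    A i = ∏ Y (suc (toℕ i)) * τ X (suc (toℕ i)) m
    B i = ∏ Y⁺ (toℕ i) * τ X⁺ (toℕ i) m

  -- Evaluating the coefficients of a series

  module _ (x : ℚ) where

    evalₛ : Series → Seriesℚ
    evalₛ f m = eval x (f m)

    evalₛ-* : ∀ f g → evalₛ (f PS.* g) ≗ evalₛ f QS.* evalₛ g
    evalₛ-* f g m = trans (eval-sum x {suc m} λ i → f (toℕ i) P.* g (m ∸ toℕ i))
      (sum-cong-≗ {suc m} λ i → eval-* x (f (toℕ i)) (g (m ∸ toℕ i)))

    evalₛ-const : ∀ p → evalₛ (constᵤ p) ≗ ℚS.const (eval x p)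
    evalₛ-const p zero    = refl
    evalₛ-const p (suc m) = refl

    evalₛ-1 : evalₛ 1ᵤ ≗ QS.1#
    evalₛ-1 zero    = eval-1 x
    evalₛ-1 (suc m) = refl

    evalₛ-u : evalₛ u ≗ ℚS.var
    evalₛ-u zero          = refl
    evalₛ-u (suc zero)    = eval-1 x
    evalₛ-u (suc (suc m)) = refl

    evalₛ-^ : ∀ n → evalₛ (u ^ᵤ n) ≗ ℚS.var QS.^ n
    evalₛ-^ zero    m = evalₛ-1 m
    evalₛ-^ (suc n) m = trans (evalₛ-* u (u ^ᵤ n) m) (conv-cong evalₛ-u (evalₛ-^ n) m)

    evalₛ-monomial : ∀ p n → evalₛ (constᵤ p *ᵤ (u ^ᵤ n)) ≗ ℚS.const (eval x p) QS.* (ℚS.var QS.^ n)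
    evalₛ-monomial p n m = trans (evalₛ-* (constᵤ p) (u ^ᵤ n) m) (conv-cong (evalₛ-const p) (evalₛ-^ n) m)

    evalₛ-linear : ∀ p → evalₛ (1ᵤ -ᵤ (constᵤ p *ᵤ u)) ≗ linear (eval x p)
    evalₛ-linear p m = trans (eval-+ x (1ᵤ m) _) (cong₂ _+_ (evalₛ-1 m)
      (trans (eval-neg x ((constᵤ p *ᵤ u) m))
        (cong -_ (trans (evalₛ-* (constᵤ p) u m) (conv-cong (evalₛ-const p) evalₛ-u m)))))

    evalₛ-product : ∀ {n} {f : Fin n → Series} {g : Fin n → Seriesℚ} → (∀ i → evalₛ (f i) ≗ g i) →
                    evalₛ (productᵤ f) ≗ QS.product g
    evalₛ-product {zero}          f≗g m = evalₛ-1 m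
    evalₛ-product {suc n} {f} {g} f≗g m =
      trans (evalₛ-* (f zero) (productᵤ (f ∘ suc)) m) (conv-cong (f≗g zero) (evalₛ-product {n} (f≗g ∘ suc)) m)

    -- The coefficients of an inverse come from a recursion in the ring operations, which evaluation
    -- preserves.
    evalₛ-inverse : ∀ {f g} → evalₛ f ≗ g → evalₛ (inverse f) ≗ ℚS.inverse g
    evalₛ-inverse {f} {g} f≗g = λ where
        zero    → eval-1 x
        (suc m) → coeffs (suc m) zero
      where
      coeffs : ∀ m i → eval x (lookup (PowerSeries.inverseCoeffs ℚ[t] f m) i) ≡ lookup (ℚS.inverseCoeffs g m) i
      coeffs zero    zero    = eval-1 x
      coeffs (suc m) (suc i) = coeffs m i
      coeffs (suc m) zero    = trans (eval-neg x (RawSemiringDefs.sum P.rawSemiring {suc m} terms)) (cong -_ (trans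
        (eval-sum x {suc m} terms)
        (sum-cong-≗ {suc m} λ i → trans (eval-* x (f (suc (toℕ i))) (lookup (PowerSeries.inverseCoeffs ℚ[t] f m) i))
          (cong₂ _*_ (f≗g (suc (toℕ i))) (coeffs m i)))))
        where
        terms : Fin (suc m) → Poly
        terms i = f (suc (toℕ i)) P.* lookup (PowerSeries.inverseCoeffs ℚ[t] f m) i

  -- Coefficients of the two sides and path weights

  var^≗shift^ : ∀ n → ℚS.var QS.^ n ≗ shift^ n QS.1#
  var^≗shift^ zero    m = refl
  var^≗shift^ (suc n) m = trans (var-conv (ℚS.var QS.^ n) m) (shift-cong (var^≗shift^ n) m)

  -- `shift^ i QS.1#` is the monomial of degree i, so only the summand i = n survives.
  sum-monomials : ∀ (a : ℕ → ℚ) n {N} → n ℕ.< N → sum {N} (λ i → a (toℕ i) * shift^ (toℕ i) QS.1# n) ≡ a n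
  sum-monomials a zero {suc N} _ = trans
    (cong₂ _+_ (ℚₚ.*-identityʳ (a 0)) (sum-zero {N} λ i → zeroʳ (a (suc (toℕ i)))))
    (ℚₚ.+-identityʳ (a 0))
  sum-monomials a (suc n) {suc N} (s≤s n<N) = trans
    (cong₂ _+_ (zeroʳ (a 0)) (sum-monomials (a ∘ suc) n n<N))
    (ℚₚ.+-identityˡ _)

  -- The second factor of `rise` is bracketed as (x - 1) - k so that its product over k is literally
  -- a falling factorial of x - 1.
  flat rise : ℚ → ℕ → ℚ
  flat x k = Q.fromℕ k * (x - Q.fromℕ k)
  rise x k = (x - Q.fromℕ k) * ((x - 1ℚ) - Q.fromℕ k)

  falling-suc : ∀ x n → Q.falling x (suc n) ≡ x * Q.falling (x - 1ℚ) n
  falling-suc x n = cong₂ _*_ (ℚₚ.+-identityʳ x) (ℚ-product-cong {n} λ i →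
    solve 2 (λ x k → x :+ :- (con 1ℚ :+ k) := (x :+ :- con 1ℚ) :+ :- k) refl x (Q.fromℕ (toℕ i)))

  ℚ-product-* : ∀ {n} (f g : Fin n → ℚ) → Q.product (λ i → f i * g i) ≡ Q.product f * Q.product g
  ℚ-product-* {zero}  f g = refl
  ℚ-product-* {suc n} f g = trans (cong (f zero * g zero *_) (ℚ-product-* (f ∘ suc) (g ∘ suc)))
    (solve 4 (λ a b c d → a :* b :* (c :* d) := a :* c :* (b :* d)) refl
      (f zero) (g zero) (Q.product (f ∘ suc)) (Q.product (g ∘ suc)))

  -- The two factors of `rise` multiply to (x)_{n+1} and (x-1)_{n+1}, and the first of these is x
  -- (x-1)_n. This produces the two falling factorials of the theorem and the spare factor x.
  ∏-rise : ∀ x n → ∏ (rise x) (suc n) ≡ x * (Q.falling (x - 1ℚ) (suc n) * Q.falling (x - 1ℚ) n)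
  ∏-rise x n = begin
    ∏ (rise x) (suc n)
      ≡⟨ ℚ-product-* {suc n} (λ i → x - Q.fromℕ (toℕ i)) (λ i → (x - 1ℚ) - Q.fromℕ (toℕ i)) ⟩
    Q.falling x (suc n) * Q.falling (x - 1ℚ) (suc n)
      ≡⟨ cong (_* Q.falling (x - 1ℚ) (suc n)) (falling-suc x n) ⟩
    x * Q.falling (x - 1ℚ) n * Q.falling (x - 1ℚ) (suc n)
      ≡⟨ solve 3 (λ x a b → x :* a :* b := x :* (b :* a)) refl x (Q.falling (x - 1ℚ) n) (Q.falling (x - 1ℚ) (suc n)) ⟩
    x * (Q.falling (x - 1ℚ) (suc n) * Q.falling (x - 1ℚ) n) ∎
    where open ≡-Reasoning

  -- The flat weight at height 0 is 0, so the first step rises and only the path after it, starting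
  -- at height 1, is expanded by `Φ-sum`.
  Φ-colourings : ∀ x n {N} → n ℕ.< N → Φ (flat x) (rise x) (suc n) ≡
    x * sum {N} λ i → Q.falling (x - 1ℚ) (suc (toℕ i)) * Q.falling (x - 1ℚ) (toℕ i) * τ (flat x ∘ suc) (toℕ i) n
  Φ-colourings x n {N} n<N = begin
    flat x 0 * Φ (flat x) (rise x) n + rise x 0 * Φ (flat x ∘ suc) (rise x ∘ suc) n
      ≡⟨ cong₂ _+_ (trans (cong (_* Φ (flat x) (rise x) n) (zeroˡ (x - 0ℚ))) (zeroˡ (Φ (flat x) (rise x) n)))
           (cong (rise x 0 *_) (Φ-sum (flat x ∘ suc) (rise x ∘ suc) n n<N)) ⟩
    0ℚ + rise x 0 * sum {N} (λ i → ∏ (rise x ∘ suc) (toℕ i) * τ′ i)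
      ≡⟨ ℚₚ.+-identityˡ _ ⟩
    rise x 0 * sum {N} (λ i → ∏ (rise x ∘ suc) (toℕ i) * τ′ i)
      ≡⟨ *-distribˡ-sum {N} (rise x 0) (λ i → ∏ (rise x ∘ suc) (toℕ i) * τ′ i) ⟩
    sum {N} (λ i → rise x 0 * (∏ (rise x ∘ suc) (toℕ i) * τ′ i))
      ≡⟨ sum-cong-≗ {N} (λ i → trans (sym (ℚₚ.*-assoc (rise x 0) (∏ (rise x ∘ suc) (toℕ i)) (τ′ i)))
           (trans (cong (_* τ′ i) (∏-rise x (toℕ i))) (ℚₚ.*-assoc x (c i) (τ′ i)))) ⟩
    sum {N} (λ i → x * (c i * τ′ i))
      ≡⟨ *-distribˡ-sum {N} x (λ i → c i * τ′ i) ⟨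
    x * sum {N} (λ i → c i * τ′ i) ∎
    where
    open ≡-Reasoning
    τ′ c : Fin N → ℚ
    τ′ i = τ (flat x ∘ suc) (toℕ i) n
    c i = Q.falling (x - 1ℚ) (suc (toℕ i)) * Q.falling (x - 1ℚ) (toℕ i)

  term : ℕ → Series
  term n = constᵤ (fallingₜ (t -ₜ 1ₜ) n *ₜ fallingₜ (t -ₜ 1ₜ) (n ∸ 1)) *ᵤ (u ^ᵤ n)
    *ᵤ inverse (productᵤ {n} λ i → 1ᵤ -ᵤ (constᵤ (fromℕₜ (suc (toℕ i)) *ₜ (t -ₜ fromℕₜ (suc (toℕ i)))) *ᵤ u))

  eval-term : ∀ x i m → eval x (term (suc i) m) ≡
    Q.falling (x - 1ℚ) (suc i) * Q.falling (x - 1ℚ) i * shift^ (suc i) (1/linears (flat x ∘ suc) (suc i)) m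
  eval-term x i m = begin
    eval x (term (suc i) m)
      ≡⟨ evalₛ-* x (constᵤ p *ᵤ (u ^ᵤ suc i)) (inverse D) m ⟩
    (evalₛ x (constᵤ p *ᵤ (u ^ᵤ suc i)) QS.* evalₛ x (inverse D)) m
      ≡⟨ conv-cong (evalₛ-monomial x p (suc i)) (evalₛ-inverse x D≗) m ⟩
    ((ℚS.const (eval x p) QS.* (ℚS.var QS.^ suc i)) QS.* 1/linears (flat x ∘ suc) (suc i)) m
      ≡⟨ monomial-conv (eval x p) (suc i) (1/linears (flat x ∘ suc) (suc i)) m ⟩
    eval x p * shift^ (suc i) (1/linears (flat x ∘ suc) (suc i)) m
      ≡⟨ cong (_* shift^ (suc i) (1/linears (flat x ∘ suc) (suc i)) m)
           (trans (eval-* x (fallingₜ (t -ₜ 1ₜ) (suc i)) (fallingₜ (t -ₜ 1ₜ) i)) (cong₂ _*_ (falls (suc i)) (falls i))) ⟩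
    Q.falling (x - 1ℚ) (suc i) * Q.falling (x - 1ℚ) i * shift^ (suc i) (1/linears (flat x ∘ suc) (suc i)) m ∎
    where
    open ≡-Reasoning
    p : Poly
    p = fallingₜ (t -ₜ 1ₜ) (suc i) *ₜ fallingₜ (t -ₜ 1ₜ) i
    coefficient : ℕ → Poly
    coefficient k = fromℕₜ (suc k) *ₜ (t -ₜ fromℕₜ (suc k))
    factor : Fin (suc i) → Series
    factor j = 1ᵤ -ᵤ (constᵤ (coefficient (toℕ j)) *ᵤ u)
    D : Series
    D = productᵤ factor

    falls : ∀ n → eval x (fallingₜ (t -ₜ 1ₜ) n) ≡ Q.falling (x - 1ℚ) n
    falls n = trans (eval-falling x (t -ₜ 1ₜ) n)
      (cong (λ y → Q.falling y n) (trans (eval-− x t 1ₜ) (cong₂ _-_ (eval-t x) (eval-1 x))))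

    eval-coefficient : ∀ k → eval x (coefficient k) ≡ flat x (suc k)
    eval-coefficient k = trans (eval-* x (fromℕₜ (suc k)) (t -ₜ fromℕₜ (suc k))) (cong₂ _*_ (eval-fromℕ x (suc k))
      (trans (eval-− x t (fromℕₜ (suc k))) (cong₂ _-_ (eval-t x) (eval-fromℕ x (suc k)))))

    D≗ : evalₛ x D ≗ linears (flat x ∘ suc) (suc i)
    D≗ = evalₛ-product x {suc i} {factor} λ j m → trans (evalₛ-linear x (coefficient (toℕ j)) m)
      (cong (λ a → linear a m) (eval-coefficient (toℕ j)))

  -- All that the power series argument uses about the characteristic polynomials.
  CountsPaths : (ℕ → Poly) → Set
  CountsPaths c = ∀ k n → let x = ι (ℤ.+ suc k) in x * eval x (c (suc n)) ≡ Φ (flat x) (rise x) (suc n)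

  -- The common sum of both sides. Both families start at n = 1, so the constant coefficient is 0.
  limit : (ℕ → Poly) → Series
  limit c zero    = []
  limit c (suc n) = c (suc n)

  module _ (c : ℕ → Poly) (c-counts : CountsPaths c) where

    monomials-HasSum : Σ≥1 (λ n → constᵤ (c n) *ᵤ (u ^ᵤ n)) HasSum limit c
    monomials-HasSum m = m , λ N m≤N → eval-injective
        {RawSemiringDefs.sum P.rawSemiring {N} λ i → (constᵤ (c (suc (toℕ i))) *ᵤ (u ^ᵤ suc (toℕ i))) m} {limit c m}
        λ k → let x = ι (ℤ.+ suc k) in begin
      eval x (RawSemiringDefs.sum P.rawSemiring {N} λ i → (constᵤ (c (suc (toℕ i))) *ᵤ (u ^ᵤ suc (toℕ i))) m)
        ≡⟨ eval-sum x {N} (λ i → (constᵤ (c (suc (toℕ i))) *ᵤ (u ^ᵤ suc (toℕ i))) m) ⟩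
      sum {N} (λ i → eval x ((constᵤ (c (suc (toℕ i))) *ᵤ (u ^ᵤ suc (toℕ i))) m))
        ≡⟨ sum-cong-≗ {N} (λ i → trans (evalₛ-monomial x (c (suc (toℕ i))) (suc (toℕ i)) m)
             (trans (const-conv (eval x (c (suc (toℕ i)))) (ℚS.var QS.^ suc (toℕ i)) m)
               (cong (eval x (c (suc (toℕ i))) *_) (var^≗shift^ (suc (toℕ i)) m)))) ⟩
      sum {N} (λ i → eval x (c (suc (toℕ i))) * shift^ (suc (toℕ i)) QS.1# m)
        ≡⟨ pick x m N m≤N ⟩
      eval x (limit c m) ∎
      where
      open ≡-Reasoning
      pick : ∀ x m N → m ℕ.≤ N → sum {N} (λ i → eval x (c (suc (toℕ i))) * shift^ (suc (toℕ i)) QS.1# m) ≡ eval x (limit c m)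
      pick x zero    N m≤N = sum-zero {N} λ i → zeroʳ (eval x (c (suc (toℕ i))))
      pick x (suc n) N m≤N = sum-monomials (λ i → eval x (c (suc i))) n m≤N

    terms-HasSum : Σ≥1 term HasSum limit c
    terms-HasSum m = m , λ N m≤N → eval-injective
        {RawSemiringDefs.sum P.rawSemiring {N} λ i → term (suc (toℕ i)) m} {limit c m}
        λ k → let x = ι (ℤ.+ suc k) in begin
      eval x (RawSemiringDefs.sum P.rawSemiring {N} λ i → term (suc (toℕ i)) m)
        ≡⟨ eval-sum x {N} (λ i → term (suc (toℕ i)) m) ⟩
      sum {N} (λ i → eval x (term (suc (toℕ i)) m))
        ≡⟨ sum-cong-≗ {N} (λ i → eval-term x (toℕ i) m) ⟩
      sum {N} (λ i → a x (toℕ i) * shift^ (suc (toℕ i)) (1/linears (flat x ∘ suc) (suc (toℕ i))) m)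
        ≡⟨ pick k m N m≤N ⟩
      eval x (limit c m) ∎
      where
      open ≡-Reasoning
      a : ℚ → ℕ → ℚ
      a x i = Q.falling (x - 1ℚ) (suc i) * Q.falling (x - 1ℚ) i

      pick : ∀ k m N → m ℕ.≤ N → let x = ι (ℤ.+ suc k) in
        sum {N} (λ i → a x (toℕ i) * shift^ (suc (toℕ i)) (1/linears (flat x ∘ suc) (suc (toℕ i))) m) ≡ eval x (limit c m)
      pick k zero    N m≤N = sum-zero {N} λ i → zeroʳ (a (ι (ℤ.+ suc k)) (toℕ i))
      -- Dropping one `shift` at degree n + 1 leaves the sum of `Φ-colourings`. Multiplied by x,
      -- both sides equal the same path weight, and x = k + 1 is not 0.
      pick k (suc n) N m≤N = *-cancelˡ-≢0 x (λ x≡0 → contradiction (ι-injective {ℤ.+ suc k} {ℤ.+ 0} x≡0) λ ())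
        (trans (sym (Φ-colourings x n m≤N)) (sym (c-counts k n)))
        where
        x = ι (ℤ.+ suc k)

-- Möbius functions and gradings

module _ where
  open import Data.Integer.Base using (_+_; _*_; -_)

  abstract

    -- Sealed so that type checking never unfolds the decision procedures; later steps go through
    -- the laws proved alongside.
    𝟙 : ∀ {a} {A : Set a} → Dec A → ℤ
    𝟙 A? = if does A? then 1ℤ else 0ℤ

    𝟙-cong : ∀ {a b} {A : Set a} {B : Set b} {A? : Dec A} {B? : Dec B} → (A → B) → (B → A) → 𝟙 A? ≡ 𝟙 B?
    𝟙-cong {A? = yes _} {yes _} f g = refl
    𝟙-cong {A? = yes a} {no ¬b} f g = contradiction (f a) ¬b
    𝟙-cong {A? = no ¬a} {yes b} f g = contradiction (g b) ¬a
    𝟙-cong {A? = no _}  {no _}  f g = refl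

    𝟙-yes : ∀ {a} {A : Set a} {A? : Dec A} → A → 𝟙 A? ≡ 1ℤ
    𝟙-yes {A? = yes _} _ = refl
    𝟙-yes {A? = no ¬a} a = contradiction a ¬a

    𝟙-no : ∀ {a} {A : Set a} {A? : Dec A} → ¬ A → 𝟙 A? ≡ 0ℤ
    𝟙-no {A? = yes a} ¬a = contradiction a ¬a
    𝟙-no {A? = no _}  _  = refl

    𝟙-× : ∀ {a b} {A : Set a} {B : Set b} (A? : Dec A) (B? : Dec B) → 𝟙 (A? ×-dec B?) ≡ 𝟙 A? * 𝟙 B?
    𝟙-× (yes _) (yes _) = refl
    𝟙-× (yes _) (no _)  = refl
    𝟙-× (no _)  B?      = refl

    𝟙-guard : ∀ {a} {A : Set a} (A? : Dec A) {x y : ℤ} → (A → x ≡ y) → 𝟙 A? * x ≡ 𝟙 A? * y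
    𝟙-guard (yes a) eq = cong (1ℤ *_) (eq a)
    𝟙-guard (no _)  eq = refl

  𝟙-yes-* : ∀ {a} {A : Set a} (A? : Dec A) x → A → 𝟙 A? * x ≡ x
  𝟙-yes-* A? x a = trans (cong (_* x) (𝟙-yes {A? = A?} a)) (ℤₚ.*-identityˡ x)

  𝟙-no-* : ∀ {a} {A : Set a} (A? : Dec A) x → ¬ A → 𝟙 A? * x ≡ 0ℤ
  𝟙-no-* A? x ¬a = cong (_* x) (𝟙-no {A? = A?} ¬a)

  ΣL : ∀ {A : Set} → List A → (A → ℤ) → ℤ
  ΣL xs f = foldr _+_ 0ℤ (List.map f xs)

  module _ {A : Set} where

    ΣL-cong : ∀ (xs : List A) {f g} → f ≗ g → ΣL xs f ≡ ΣL xs g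
    ΣL-cong xs f≗g = cong (foldr _+_ 0ℤ) (Listₚ.map-cong f≗g xs)

    ΣL-0 : ∀ (xs : List A) {f} → All (λ x → f x ≡ 0ℤ) xs → ΣL xs f ≡ 0ℤ
    ΣL-0 []       []         = refl
    ΣL-0 (x ∷ xs) (fx0 ∷ f0) = cong₂ _+_ fx0 (ΣL-0 xs f0)

    ΣL-+ : ∀ (xs : List A) f g → ΣL xs (λ x → f x + g x) ≡ ΣL xs f + ΣL xs g
    ΣL-+ []       f g = refl
    ΣL-+ (x ∷ xs) f g = trans (cong (f x + g x +_) (ΣL-+ xs f g)) (rearrange (f x) (g x) (ΣL xs f) (ΣL xs g))
      where
      rearrange : ∀ a b c d → a + b + (c + d) ≡ a + c + (b + d)
      rearrange = solve-∀

    ΣL-*ʳ : ∀ (xs : List A) f c → ΣL xs (λ x → f x * c) ≡ ΣL xs f * c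
    ΣL-*ʳ []       f c = refl
    ΣL-*ʳ (x ∷ xs) f c = trans (cong (f x * c +_) (ΣL-*ʳ xs f c)) (sym (ℤₚ.*-distribʳ-+ c (f x) (ΣL xs f)))

    ΣL-collect : ∀ {P : Pred A 0ℓ} (P? : Decidable P) f xs →
                 ΣL (collect P? xs) (f ∘ proj₁) ≡ ΣL xs (λ x → 𝟙 (P? x) * f x)
    ΣL-collect P? f []       = refl
    ΣL-collect P? f (x ∷ xs) with P? x
    ... | yes px = cong₂ _+_ (sym (𝟙-yes-* (yes px) (f x) px)) (ΣL-collect P? f xs)
    ... | no ¬px = trans (ΣL-collect P? f xs) (trans (sym (ℤₚ.+-identityˡ _))
      (cong (_+ ΣL xs (λ y → 𝟙 (P? y) * f y)) (sym (𝟙-no-* (no ¬px) (f x) ¬px))))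

    max-≤ : ∀ (xs : List A) {f : A → ℕ} {b} → (∀ x → f x ℕ.≤ b) → foldr _⊔_ 0 (List.map f xs) ℕ.≤ b
    max-≤ []       f≤b = z≤n
    max-≤ (x ∷ xs) f≤b = ℕₚ.⊔-lub (f≤b x) (max-≤ xs f≤b)

    ≤-max : ∀ {xs : List A} {f : A → ℕ} {b} → Any (λ x → b ℕ.≤ f x) xs → b ℕ.≤ foldr _⊔_ 0 (List.map f xs)
    ≤-max {x ∷ xs} {f} (here b≤)   = ℕₚ.≤-trans b≤ (ℕₚ.m≤m⊔n (f x) _)
    ≤-max {x ∷ xs} {f} (there b≤) = ℕₚ.≤-trans (≤-max b≤) (ℕₚ.m≤n⊔m (f x) _)

  module _ (S : DecSetoid 0ℓ 0ℓ) where
    open DecSetoid S using (Carrier; _≈_; _≟_; setoid) renaming (sym to ≈-sym; trans to ≈-trans)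

    ΣL-𝟙≈ : ∀ {xs : List Carrier} {y} → Unique setoid xs → Any (y ≈_) xs → ΣL xs (λ x → 𝟙 (x ≟ y)) ≡ 1ℤ
    ΣL-𝟙≈ {x ∷ xs} {y} (x∉ ∷ xs!) (here y≈x) = cong₂ _+_ (𝟙-yes (≈-sym y≈x))
      (ΣL-0 xs (All.map (λ x≉z → 𝟙-no λ z≈y → x≉z (≈-trans (≈-sym y≈x) (≈-sym z≈y))) x∉))
    ΣL-𝟙≈ {x ∷ xs} {y} (x∉ ∷ xs!) (there y∈xs) = cong₂ _+_
      (𝟙-no λ x≈y → All.lookupWith (λ x≉z y≈z → x≉z (≈-trans x≈y y≈z)) x∉ y∈xs) (ΣL-𝟙≈ xs! y∈xs)

  module _ (P : FinitePoset) where
    open FinitePoset P renaming (refl to ≤-refl; trans to ≤-trans)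
    module ≈ = Eq

    -- The recursion hands down the accessibility proofs found inside `acc`; exchanging them for
    -- `<-wf` turns the recursive values into values of `μ`.
    μ-acc-irrelevant : ∀ x y (a b : Acc _<_ y) → μ-acc x y a ≡ μ-acc x y b
    μ-acc-irrelevant x y (acc rs) (acc rs′) = cong (λ s → if does (x ≟ y) then 1ℤ else - s)
      (ΣL-cong (halfOpen x y) λ (z , _ , z<y) → μ-acc-irrelevant x z (rs z<y) (rs′ z<y))

    -- Summed over all elements with an indicator, so that different intervals can be compared term
    -- by term.
    Σ[_,_⟩μ : Carrier → Carrier → ℤ
    Σ[ x , y ⟩μ = ΣL elements λ z → 𝟙 ((x ≤? z) ×-dec (z <? y)) * μ x z

    μ-unfold : ∀ x y → μ x y ≡ (if does (x ≟ y) then 1ℤ else - Σ[ x , y ⟩μ)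
    μ-unfold x y = unfold (<-wf y)
      where
      unfold : ∀ a → μ-acc x y a ≡ (if does (x ≟ y) then 1ℤ else - Σ[ x , y ⟩μ)
      unfold (acc rs) = cong (λ s → if does (x ≟ y) then 1ℤ else - s) (trans
        (ΣL-cong (halfOpen x y) λ (z , _ , z<y) → μ-acc-irrelevant x z (rs z<y) (<-wf z))
        (ΣL-collect (λ z → (x ≤? z) ×-dec (z <? y)) (μ x) elements))

    μ-≈ : ∀ {x y} → x ≈ y → μ x y ≡ 1ℤ
    μ-≈ {x} {y} x≈y with x ≟ y | μ-unfold x y
    ... | yes _  | eq = eq
    ... | no x≉y | _  = contradiction x≈y x≉y

    μ-≉ : ∀ {x y} → ¬ x ≈ y → μ x y ≡ - Σ[ x , y ⟩μ
    μ-≉ {x} {y} x≉y with x ≟ y | μ-unfold x y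
    ... | yes x≈y | _  = contradiction x≈y x≉y
    ... | no _    | eq = eq

    μ-congʳ : ∀ x {y y′} → y ≈ y′ → μ x y ≡ μ x y′
    μ-congʳ x {y} {y′} y≈y′ = trans (μ-unfold x y) (trans (equal (x ≟ y) (x ≟ y′)) (sym (μ-unfold x y′)))
      where
      sums : Σ[ x , y ⟩μ ≡ Σ[ x , y′ ⟩μ
      sums = ΣL-cong elements λ z → cong (_* μ x z) (𝟙-cong
        (λ (x≤z , z<y) → x≤z , <-respʳ-≈ y≈y′ z<y)
        (λ (x≤z , z<y′) → x≤z , <-respʳ-≈ (≈.sym y≈y′) z<y′))
        where
        <-respʳ-≈ : ∀ {z w w′} → w ≈ w′ → z < w → z < w′
        <-respʳ-≈ w≈w′ (z≤w , z≉w) = ≤-trans z≤w (reflexive w≈w′) , λ z≈w′ → z≉w (≈.trans z≈w′ (≈.sym w≈w′))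
      equal : ∀ (d : Dec (x ≈ y)) (d′ : Dec (x ≈ y′)) →
              (if does d then 1ℤ else - Σ[ x , y ⟩μ) ≡ (if does d′ then 1ℤ else - Σ[ x , y′ ⟩μ)
      equal (yes _)   (yes _)    = refl
      equal (yes x≈y) (no x≉y′)  = contradiction (≈.trans x≈y y≈y′) x≉y′
      equal (no x≉y)  (yes x≈y′) = contradiction (≈.trans x≈y′ (≈.sym y≈y′)) x≉y
      equal (no _)    (no _)     = cong -_ sums

    -- For y other than 0̂ the recursion makes μ(0̂, y) cancel the sum over z < y; for y = 0̂
    -- nothing lies strictly below.
    Σμ-below : ∀ y → ΣL elements (λ z → 𝟙 (z ≤? y) * μ 0̂ z) ≡ 𝟙 (0̂ ≟ y)
    Σμ-below y = begin
      ΣL elements (λ z → 𝟙 (z ≤? y) * μ 0̂ z)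
        ≡⟨ ΣL-cong elements (λ z → trans (cong (_* μ 0̂ z) (split z (z ≟ y)))
             (ℤₚ.*-distribʳ-+ (μ 0̂ z) (𝟙 ((0̂ ≤? z) ×-dec (z <? y))) (𝟙 (z ≟ y)))) ⟩
      ΣL elements (λ z → 𝟙 ((0̂ ≤? z) ×-dec (z <? y)) * μ 0̂ z + 𝟙 (z ≟ y) * μ 0̂ z)
        ≡⟨ ΣL-+ elements _ _ ⟩
      Σ[ 0̂ , y ⟩μ + ΣL elements (λ z → 𝟙 (z ≟ y) * μ 0̂ z)
        -- The enumeration is complete and without repetition, so exactly one listed z is equivalent
        -- to y.
        ≡⟨ cong (Σ[ 0̂ , y ⟩μ +_) (trans (ΣL-cong elements λ z → 𝟙-guard (z ≟ y) (μ-congʳ 0̂)) (trans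
             (ΣL-*ʳ elements _ (μ 0̂ y))
             (trans (cong (_* μ 0̂ y) (ΣL-𝟙≈ Eq.decSetoid elements-unique (elements-complete y))) (ℤₚ.*-identityˡ _)))) ⟩
      Σ[ 0̂ , y ⟩μ + μ 0̂ y
        ≡⟨ total (0̂ ≟ y) ⟩
      𝟙 (0̂ ≟ y) ∎
      where
      open ≡-Reasoning
      split : ∀ z (d : Dec (z ≈ y)) → 𝟙 (z ≤? y) ≡ 𝟙 ((0̂ ≤? z) ×-dec (z <? y)) + 𝟙 d
      split z (yes z≈y) = trans (𝟙-yes (reflexive z≈y))
        (sym (cong₂ _+_ (𝟙-no {A? = (0̂ ≤? z) ×-dec (z <? y)} λ (_ , _ , z≉y) → z≉y z≈y) (𝟙-yes {A? = yes z≈y} z≈y)))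
      split z (no z≉y)  = trans (𝟙-cong {B? = (0̂ ≤? z) ×-dec (z <? y)} (λ z≤y → 0̂-minimum z , z≤y , z≉y) (proj₁ ∘ proj₂))
        (sym (trans (cong (𝟙 ((0̂ ≤? z) ×-dec (z <? y)) +_) (𝟙-no {A? = no z≉y} z≉y)) (ℤₚ.+-identityʳ _)))

      total : (d : Dec (0̂ ≈ y)) → Σ[ 0̂ , y ⟩μ + μ 0̂ y ≡ 𝟙 d
      total (yes 0̂≈y) = trans (cong₂ _+_ (ΣL-0 elements (All.universal nothing-below elements)) (μ-≈ 0̂≈y))
        (sym (𝟙-yes 0̂≈y))
        where
        nothing-below : ∀ z → 𝟙 ((0̂ ≤? z) ×-dec (z <? y)) * μ 0̂ z ≡ 0ℤ
        nothing-below z = 𝟙-no-* ((0̂ ≤? z) ×-dec (z <? y)) (μ 0̂ z) λ (0̂≤z , z≤y , z≉y) →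
          z≉y (antisym z≤y (≤-trans (reflexive (≈.sym 0̂≈y)) 0̂≤z))
      total (no 0̂≉y) = trans (cong (Σ[ 0̂ , y ⟩μ +_) (μ-≉ 0̂≉y))
        (trans (ℤₚ.+-inverseʳ Σ[ 0̂ , y ⟩μ) (sym (𝟙-no 0̂≉y)))

    -- A certificate that the longest-chain rank is the function g: `g-mono` bounds every chain from
    -- above, and `g-cover` supplies chains that reach the bound.
    record Grading : Set where
      field
        g       : Carrier → ℕ
        g-cong  : ∀ {x y} → x ≈ y → g x ≡ g y
        g-0̂     : g 0̂ ≡ 0
        g-mono  : ∀ {x y} → x < y → g x ℕ.< g y
        g-cover : ∀ {z x} → z < x → ∃[ y ] z < y × y ≤ x × g y ≡ suc (g z)

      coatom : ∀ {x} → 0̂ < x → ∃[ z ] z < x × suc (g z) ≡ g x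
      coatom {x} 0̂<x = climb (g x ∸ suc (g 0̂)) 0̂<x (sym (ℕₚ.m∸n+n≡m (g-mono 0̂<x)))
        where
        -- d is the number of levels strictly between z and x; each use of `g-cover` goes up one
        -- level, until z lies directly below x.
        climb : ∀ d {z} → z < x → g x ≡ d ℕ.+ suc (g z) → ∃[ z ] z < x × suc (g z) ≡ g x
        climb zero    z<x eq = _ , z<x , sym eq
        climb (suc d) {z} z<x eq with g-cover z<x
        ... | y , z<y , y≤x , gy with y ≟ x
        ...   | yes y≈x = z , z<x , trans (sym gy) (g-cong y≈x)
        ...   | no  y≉x = climb d (y≤x , y≉x)
          (trans eq (trans (sym (ℕₚ.+-suc d (suc (g z)))) (cong (λ k → d ℕ.+ suc k) (sym gy))))

      -- By induction the elements below x have rank g. Strict monotonicity gives the upper bound,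
      -- and a coatom attains it unless x is the minimum, where g is 0.
      rk-acc≡g : ∀ x (a : Acc _<_ x) → rk-acc x a ≡ g x
      rk-acc≡g x (acc rs) = ℕₚ.≤-antisym
        (max-≤ (below x) λ (z , z<x) → subst (ℕ._< g x) (sym (rk-acc≡g z (rs z<x))) (g-mono z<x))
        (attained (0̂ ≟ x))
        where
        attained : Dec (0̂ ≈ x) → g x ℕ.≤ rk-acc x (acc rs)
        attained (yes 0̂≈x) = subst (ℕ._≤ _) (trans (sym g-0̂) (g-cong 0̂≈x)) z≤n
        attained (no  0̂≉x) with coatom (0̂-minimum x , 0̂≉x)
        ... | z , z<x , eq = ≤-max (found elements (elements-complete z))
          where
          found : ∀ xs → Any (z ≈_) xs → Any (λ w → g x ℕ.≤ suc (rk-acc (proj₁ w) (rs (proj₂ w)))) (collect (_<? x) xs)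
          found (w ∷ xs) (here z≈w) with w <? x
          ... | yes w<x = here (ℕₚ.≤-reflexive (trans (sym eq) (cong suc (trans (g-cong z≈w) (sym (rk-acc≡g w (rs w<x)))))))
          ... | no  w≮x = contradiction (<-respˡ-≈ z≈w z<x) w≮x
          found (w ∷ xs) (there z∈) with w <? x
          ... | yes _ = there (found xs z∈)
          ... | no  _ = found xs z∈

      rk≡g : ∀ x → rk x ≡ g x
      rk≡g x = rk-acc≡g x (<-wf x)

      len≡g : ∀ {1̂} → (∀ x → x ≤ 1̂) → len ≡ g 1̂
      len≡g {1̂} x≤1̂ = ℕₚ.≤-antisym
        (max-≤ elements λ x → subst (ℕ._≤ g 1̂) (sym (rk≡g x)) (bound x (x ≟ 1̂)))
        (≤-max (Any.map (λ {x} 1̂≈x → ℕₚ.≤-reflexive (trans (g-cong 1̂≈x) (sym (rk≡g x)))) (elements-complete 1̂)))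
        where
        bound : ∀ x → Dec (x ≈ 1̂) → g x ℕ.≤ g 1̂
        bound x (yes x≈1̂) = ℕₚ.≤-reflexive (g-cong x≈1̂)
        bound x (no  x≉1̂) = ℕₚ.<⇒≤ (g-mono (x≤1̂ x , x≉1̂))

  -- Sums over colourings

  module _ {q : ℕ} where

    ΣV : ∀ m → (Vec (Fin q) m → ℤ) → ℤ
    ΣV zero    f = f []
    ΣV (suc m) f = Σℤ.sum λ c → ΣV m λ κ → f (c ∷ κ)

    ΣV-cong : ∀ m {f g} → f ≗ g → ΣV m f ≡ ΣV m g
    ΣV-cong zero    f≗g = f≗g []
    ΣV-cong (suc m) f≗g = Σℤ.sum-cong-≗ {q} λ c → ΣV-cong m λ κ → f≗g (c ∷ κ)

    ΣV-0 : ∀ m → ΣV m (λ _ → 0ℤ) ≡ 0ℤ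
    ΣV-0 zero    = refl
    ΣV-0 (suc m) = trans (Σℤ.sum-cong-≗ {q} λ _ → ΣV-0 m) (Σℤ.sum-replicate-zero q)

    ΣV-+ : ∀ m f g → ΣV m (λ κ → f κ + g κ) ≡ ΣV m f + ΣV m g
    ΣV-+ zero    f g = refl
    ΣV-+ (suc m) f g = trans (Σℤ.sum-cong-≗ {q} λ c → ΣV-+ m (λ κ → f (c ∷ κ)) (λ κ → g (c ∷ κ)))
      (Σℤ.∑-distrib-+ {q} (λ c → ΣV m λ κ → f (c ∷ κ)) (λ c → ΣV m λ κ → g (c ∷ κ)))

    ΣV-*ˡ : ∀ m a f → ΣV m (λ κ → a * f κ) ≡ a * ΣV m f
    ΣV-*ˡ zero    a f = refl
    ΣV-*ˡ (suc m) a f = trans (Σℤ.sum-cong-≗ {q} λ c → ΣV-*ˡ m a (λ κ → f (c ∷ κ)))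
      (sym (Σℤ.*-distribˡ-sum {q} a λ c → ΣV m λ κ → f (c ∷ κ)))

    ΣV-sum : ∀ m {n} (f : Fin n → Vec (Fin q) m → ℤ) → Σℤ.sum (λ c → ΣV m (f c)) ≡ ΣV m (λ κ → Σℤ.sum λ c → f c κ)
    ΣV-sum m {zero}  f = sym (ΣV-0 m)
    ΣV-sum m {suc n} f = trans (cong (ΣV m (f zero) +_) (ΣV-sum m (f ∘ suc))) (sym (ΣV-+ m (f zero) _))

    ΣV-ΣL : ∀ m {A : Set} (xs : List A) (f : A → Vec (Fin q) m → ℤ) →
            ΣL xs (λ x → ΣV m (f x)) ≡ ΣV m (λ κ → ΣL xs λ x → f x κ)
    ΣV-ΣL m []       f = sym (ΣV-0 m)
    ΣV-ΣL m (x ∷ xs) f = trans (cong (ΣV m (f x) +_) (ΣV-ΣL m xs f)) (sym (ΣV-+ m (f x) _))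

  sum-1 : ∀ n → Σℤ.sum {n} (λ _ → 1ℤ) ≡ ℤ.+ n
  sum-1 zero    = refl
  sum-1 (suc n) = cong (1ℤ +_) (sum-1 n)

  sum-𝟙≡ : ∀ {n} (c : Fin n) → Σℤ.sum (λ i → 𝟙 (i ≟ᶠ c)) ≡ 1ℤ
  sum-𝟙≡ {suc n} zero    = cong₂ _+_ (𝟙-yes {A? = zero ≟ᶠ zero} refl)
    (trans (Σℤ.sum-cong-≗ {n} λ i → 𝟙-no {A? = suc i ≟ᶠ zero} λ ()) (Σℤ.sum-replicate-zero n))
  sum-𝟙≡ {suc n} (suc c) = cong₂ _+_ (𝟙-no {A? = zero ≟ᶠ suc c} λ ())
    (trans (Σℤ.sum-cong-≗ {n} λ i → 𝟙-cong {A? = suc i ≟ᶠ suc c} {i ≟ᶠ c} (λ { refl → refl }) (cong suc)) (sum-𝟙≡ c))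

  -- Equivalence relations on Fin m

  Laterᵣ : ∀ {m} → Rel (Fin (suc m)) 0ℓ → Set
  Laterᵣ R = ∃[ j ] R zero (suc j)

  module _ {m} {R : Rel (Fin (suc m)) 0ℓ} (R? : B.Decidable R) where

    later? : Dec (Laterᵣ R)
    later? = any? λ j → R? zero (suc j)

  tail? : ∀ {m} {R : Rel (Fin (suc m)) 0ℓ} → B.Decidable R → B.Decidable (R on suc)
  tail? R? i j = R? (suc i) (suc j)

  lastCount : ∀ {A : Set} → Dec A → ℕ
  lastCount d = if does d then 0 else 1

  -- Each class is counted at its largest element.
  #classes : ∀ {m} {R : Rel (Fin m) 0ℓ} → B.Decidable R → ℕ
  #classes {zero}  R? = 0
  #classes {suc m} R? = lastCount (later? R?) ℕ.+ #classes (tail? R?)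

  lastCount-≤ : ∀ {A B : Set} (A? : Dec A) (B? : Dec B) → (A → B) → lastCount B? ℕ.≤ lastCount A?
  lastCount-≤ (yes a) (yes b) f = z≤n
  lastCount-≤ (yes a) (no ¬b) f = contradiction (f a) ¬b
  lastCount-≤ (no ¬a) (yes b) f = z≤n
  lastCount-≤ (no ¬a) (no ¬b) f = ℕₚ.≤-refl

  lastCount-yes : ∀ {A : Set} (A? : Dec A) → A → lastCount A? ≡ 0
  lastCount-yes (yes _) a = refl
  lastCount-yes (no ¬a) a = contradiction a ¬a

  lastCount-no : ∀ {A : Set} (A? : Dec A) → ¬ A → lastCount A? ≡ 1
  lastCount-no (yes a) ¬a = contradiction a ¬a
  lastCount-no (no _)  ¬a = refl

  -- A larger relation can only give elements additional later partners, so fewer of them are last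
  -- in their class.
  #classes-antitone : ∀ {m} {R S : Rel (Fin m) 0ℓ} (R? : B.Decidable R) (S? : B.Decidable S) →
                      (∀ i j → R i j → S i j) → #classes S? ℕ.≤ #classes R?
  #classes-antitone {zero}  R? S? R⊆S = z≤n
  #classes-antitone {suc m} R? S? R⊆S = ℕₚ.+-mono-≤
    (lastCount-≤ (later? R?) (later? S?) λ (j , r) → j , R⊆S zero (suc j) r)
    (#classes-antitone (tail? R?) (tail? S?) λ i j → R⊆S (suc i) (suc j))

  #classes-cong : ∀ {m} {R S : Rel (Fin m) 0ℓ} (R? : B.Decidable R) (S? : B.Decidable S) →
                  (∀ i j → R i j → S i j) → (∀ i j → S i j → R i j) → #classes R? ≡ #classes S?
  #classes-cong R? S? R⊆S S⊆R = ℕₚ.≤-antisym (#classes-antitone S? R? S⊆R) (#classes-antitone R? S? R⊆S)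

  #classes-discrete : ∀ {m} {R : Rel (Fin m) 0ℓ} (R? : B.Decidable R) → (∀ {i j} → R i j → i ≡ j) → #classes R? ≡ m
  #classes-discrete {zero}  R? R⊆≡ = refl
  #classes-discrete {suc m} R? R⊆≡ = cong₂ ℕ._+_
    (lastCount-no (later? R?) λ (j , r) → contradiction (R⊆≡ r) λ ())
    (#classes-discrete (tail? R?) λ r → suc-injective (R⊆≡ r))
    where open import Data.Fin.Properties using (suc-injective)

  #classes-total : ∀ {m} {R : Rel (Fin (suc m)) 0ℓ} (R? : B.Decidable R) → (∀ i j → R i j) → #classes R? ≡ 1
  #classes-total {zero}  R? R-all = cong (ℕ._+ 0) (lastCount-no (later? R?) λ ())
  #classes-total {suc m} R? R-all = cong₂ ℕ._+_
    (lastCount-yes (later? R?) (zero , R-all zero (suc zero)))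
    (#classes-total (tail? R?) λ i j → R-all (suc i) (suc j))

  #classes-≤ : ∀ {m} {R : Rel (Fin m) 0ℓ} (R? : B.Decidable R) → #classes R? ℕ.≤ m
  #classes-≤ {zero}  R? = z≤n
  #classes-≤ {suc m} R? = ℕₚ.+-mono-≤ (bound (later? R?)) (#classes-≤ (tail? R?))
    where
    bound : ∀ {A : Set} (d : Dec A) → lastCount d ℕ.≤ 1
    bound (yes _) = z≤n
    bound (no _)  = ℕₚ.≤-refl

  on-suc : ∀ {m} {R : Rel (Fin (suc m)) 0ℓ} → IsEquivalence R → IsEquivalence (R on suc)
  on-suc R-eq = record { refl = R.refl ; sym = R.sym ; trans = R.trans }
    where module R = IsEquivalence R-eq

  module _ {m} (R : Rel (Fin m) 0ℓ) (a b : Fin m) where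

    Merge : Rel (Fin m) 0ℓ
    Merge i j = R i j ⊎ (R i a × R b j ⊎ R i b × R a j)

    merge? : B.Decidable R → B.Decidable Merge
    merge? R? i j = R? i j ⊎-dec ((R? i a ×-dec R? b j) ⊎-dec (R? i b ×-dec R? a j))

  module _ {m} {R : Rel (Fin m) 0ℓ} {a b : Fin m} (R-eq : IsEquivalence R) where
    private module R = IsEquivalence R-eq

    merge-isEquivalence : IsEquivalence (Merge R a b)
    merge-isEquivalence = record { refl = inj₁ R.refl ; sym = symm ; trans = transit }
      where
      symm : B.Symmetric (Merge R a b)
      symm (inj₁ r)              = inj₁ (R.sym r)
      symm (inj₂ (inj₁ (p , q))) = inj₂ (inj₂ (R.sym q , R.sym p))
      symm (inj₂ (inj₂ (p , q))) = inj₂ (inj₁ (R.sym q , R.sym p))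

      transit : B.Transitive (Merge R a b)
      transit (inj₁ r)              (inj₁ s)              = inj₁ (R.trans r s)
      transit (inj₁ r)              (inj₂ (inj₁ (p , q))) = inj₂ (inj₁ (R.trans r p , q))
      transit (inj₁ r)              (inj₂ (inj₂ (p , q))) = inj₂ (inj₂ (R.trans r p , q))
      transit (inj₂ (inj₁ (p , q))) (inj₁ s)              = inj₂ (inj₁ (p , R.trans q s))
      transit (inj₂ (inj₂ (p , q))) (inj₁ s)              = inj₂ (inj₂ (p , R.trans q s))
      transit (inj₂ (inj₁ (p , q))) (inj₂ (inj₁ (r , s))) = inj₂ (inj₁ (p , s))
      transit (inj₂ (inj₁ (p , q))) (inj₂ (inj₂ (r , s))) = inj₁ (R.trans p s)
      transit (inj₂ (inj₂ (p , q))) (inj₂ (inj₁ (r , s))) = inj₁ (R.trans p s)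
      transit (inj₂ (inj₂ (p , q))) (inj₂ (inj₂ (r , s))) = inj₂ (inj₂ (p , s))

  mutual

    -- Elements are peeled off until a or b is 0. As long as neither is, merging does not affect
    -- whether 0 is last in its class.
    #classes-merge : ∀ {m} {R : Rel (Fin m) 0ℓ} (R? : B.Decidable R) → IsEquivalence R → ∀ {a b} → ¬ R a b →
                     suc (#classes (merge? R a b R?)) ≡ #classes R?
    #classes-merge {suc m} R? R-eq {zero} {zero}  a≁b = contradiction (IsEquivalence.refl R-eq) a≁b
    #classes-merge {suc m} R? R-eq {zero} {suc b} a≁b = #classes-merge-zero R? R-eq a≁b
    #classes-merge {suc m} {R} R? R-eq {suc a} {zero} a≁b = trans
      (cong suc (#classes-cong (merge? R (suc a) zero R?) (merge? R zero (suc a) R?) (λ i j → flip) (λ i j → flip)))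
      (#classes-merge-zero R? R-eq (a≁b ∘ IsEquivalence.sym R-eq))
      where
      flip : ∀ {a b i j} → Merge R a b i j → Merge R b a i j
      flip (inj₁ r)        = inj₁ r
      flip (inj₂ (inj₁ p)) = inj₂ (inj₂ p)
      flip (inj₂ (inj₂ p)) = inj₂ (inj₁ p)
    #classes-merge {suc m} {R} R? R-eq {suc a} {suc b} a≁b = begin
      suc (lastCount (later? M?) ℕ.+ #classes (tail? M?))   ≡⟨ ℕₚ.+-suc _ _ ⟨
      lastCount (later? M?) ℕ.+ suc (#classes (tail? M?))
        ≡⟨ cong₂ ℕ._+_ same-later (#classes-merge (tail? R?) (on-suc R-eq) a≁b) ⟩
      lastCount (later? R?) ℕ.+ #classes (tail? R?)         ∎
      where
      open ≡-Reasoning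
      M? = merge? R (suc a) (suc b) R?

      -- If merging relates 0 to a later element through a or b, then that one of the two is itself
      -- a later partner of 0 under R.
      earlier : Laterᵣ (Merge R (suc a) (suc b)) → Laterᵣ R
      earlier (j , inj₁ r)              = j , r
      earlier (j , inj₂ (inj₁ (p , _))) = a , p
      earlier (j , inj₂ (inj₂ (p , _))) = b , p

      same-later : lastCount (later? M?) ≡ lastCount (later? R?)
      same-later = ℕₚ.≤-antisym
        (lastCount-≤ (later? R?) (later? M?) λ (j , r) → j , inj₁ r)
        (lastCount-≤ (later? M?) (later? R?) earlier)

    -- If 0 has a later partner k, then merging with 0 acts on the tail as merging with k. Otherwise
    -- 0 was a class of its own: it stops being counted, and the tail is unchanged.
    #classes-merge-zero : ∀ {m} {R : Rel (Fin (suc m)) 0ℓ} (R? : B.Decidable R) → IsEquivalence R → ∀ {b} → ¬ R zero (suc b) →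
                          suc (#classes (merge? R zero (suc b) R?)) ≡ #classes R?
    #classes-merge-zero {m} {R} R? R-eq {b} 0≁b with later? R?
    ... | yes (k , 0~k) = begin
      suc (lastCount (later? M?) ℕ.+ #classes (tail? M?))
        ≡⟨ cong (λ c → suc (c ℕ.+ #classes (tail? M?))) (lastCount-yes (later? M?) (k , inj₁ 0~k)) ⟩
      suc (#classes (tail? M?))
        ≡⟨ cong suc (#classes-cong (tail? M?) (merge? (R on suc) k b (tail? R?)) (λ i j → to) (λ i j → from)) ⟩
      suc (#classes (merge? (R on suc) k b (tail? R?)))
        ≡⟨ #classes-merge (tail? R?) (on-suc R-eq) (0≁b ∘ R.trans 0~k) ⟩
      #classes (tail? R?)                                       ∎
      where
      open ≡-Reasoning
      module R = IsEquivalence R-eq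
      M? = merge? R zero (suc b) R?

      to : ∀ {i j} → Merge R zero (suc b) (suc i) (suc j) → Merge (R on suc) k b i j
      to (inj₁ r)              = inj₁ r
      to (inj₂ (inj₁ (p , q))) = inj₂ (inj₁ (R.trans p 0~k , q))
      to (inj₂ (inj₂ (p , q))) = inj₂ (inj₂ (p , R.trans (R.sym 0~k) q))

      from : ∀ {i j} → Merge (R on suc) k b i j → Merge R zero (suc b) (suc i) (suc j)
      from (inj₁ r)              = inj₁ r
      from (inj₂ (inj₁ (p , q))) = inj₂ (inj₁ (R.trans p (R.sym 0~k) , q))
      from (inj₂ (inj₂ (p , q))) = inj₂ (inj₂ (p , R.trans 0~k q))
    ... | no alone = begin
      suc (lastCount (later? M?) ℕ.+ #classes (tail? M?))
        ≡⟨ cong (λ c → suc (c ℕ.+ #classes (tail? M?))) (lastCount-yes (later? M?) (b , inj₂ (inj₁ (R.refl , R.refl)))) ⟩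
      suc (#classes (tail? M?))
        ≡⟨ cong suc (#classes-cong (tail? M?) (tail? R?) (λ i j → to) (λ i j → inj₁)) ⟩
      suc (#classes (tail? R?))                                 ∎
      where
      open ≡-Reasoning
      module R = IsEquivalence R-eq
      M? = merge? R zero (suc b) R?

      to : ∀ {i j} → Merge R zero (suc b) (suc i) (suc j) → R (suc i) (suc j)
      to (inj₁ r)                  = r
      to {i} (inj₂ (inj₁ (p , q))) = contradiction (i , R.sym p) alone
      to {_} {j} (inj₂ (inj₂ (p , q))) = contradiction (j , q) alone

  -- Colourings constant on the classes of a relation

  module _ {q m : ℕ} where

    Constant : Rel (Fin m) 0ℓ → Vec (Fin q) m → Set
    Constant R κ = ∀ i j → R i j → lookup κ i ≡ lookup κ j

    abstract
      constant? : ∀ {R} → B.Decidable R → ∀ κ → Dec (Constant R κ)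
      constant? R? κ = all? λ i → all? λ j → R? i j →-dec (lookup κ i ≟ᶠ lookup κ j)

  -- The colour of vertex 0 is forced if its class has a later element and free otherwise. Counting
  -- classes at their largest elements fits this order of peeling.
  ΣV-constant : ∀ {q m} {R : Rel (Fin m) 0ℓ} (R? : B.Decidable R) → IsEquivalence R →
                ΣV {q} m (λ κ → 𝟙 (constant? R? κ)) ≡ (ℤ.+ q) ℤ.^ #classes R?
  ΣV-constant {q} {zero}  R? R-eq = 𝟙-yes {A? = constant? {q} R? []} λ ()
  ΣV-constant {q} {suc m} {R} R? R-eq with later? R?
  ... | yes (k , 0~k) = begin
    -- The sums are interchanged so that, for fixed κ, exactly one colour c of vertex 0 fits.
    Σℤ.sum {q} (λ c → ΣV m λ κ → 𝟙 (constant? R? (c ∷ κ)))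
      ≡⟨ ΣV-sum {q} m {q} (λ c κ → 𝟙 (constant? R? (c ∷ κ))) ⟩
    ΣV m (λ κ → Σℤ.sum {q} λ c → 𝟙 (constant? R? (c ∷ κ)))
      ≡⟨ ΣV-cong m (λ κ → trans
           (Σℤ.sum-cong-≗ {q} λ c → trans
             (𝟙-cong {A? = constant? R? (c ∷ κ)} {constant? (tail? R?) κ ×-dec (c ≟ᶠ lookup κ k)}
               (λ h → (λ i j → h (suc i) (suc j)) , h zero (suc k) 0~k) (λ (h , c≡) → extend κ c h c≡))
             (𝟙-× (constant? (tail? R?) κ) (c ≟ᶠ lookup κ k)))
           (trans (sym (Σℤ.*-distribˡ-sum {q} (𝟙 (constant? (tail? R?) κ)) λ c → 𝟙 (c ≟ᶠ lookup κ k)))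
             (trans (cong (𝟙 (constant? (tail? R?) κ) *_) (sum-𝟙≡ (lookup κ k))) (ℤₚ.*-identityʳ _)))) ⟩
    ΣV m (λ κ → 𝟙 (constant? (tail? R?) κ))
      ≡⟨ ΣV-constant {q} (tail? R?) (on-suc R-eq) ⟩
    (ℤ.+ q) ℤ.^ #classes (tail? R?) ∎
    where
    open ≡-Reasoning
    module R = IsEquivalence R-eq
    extend : ∀ κ c → Constant (R on suc) κ → c ≡ lookup κ k → Constant R (c ∷ κ)
    extend κ c h c≡ zero    zero    r = refl
    extend κ c h c≡ zero    (suc j) r = trans c≡ (h k j (R.trans (R.sym 0~k) r))
    extend κ c h c≡ (suc i) zero    r = trans (h i k (R.trans r 0~k)) (sym c≡)
    extend κ c h c≡ (suc i) (suc j) r = h i j r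
  ... | no alone = begin
    Σℤ.sum {q} (λ c → ΣV m λ κ → 𝟙 (constant? R? (c ∷ κ)))
      ≡⟨ Σℤ.sum-cong-≗ {q} (λ c → ΣV-cong m λ κ → 𝟙-cong {A? = constant? R? (c ∷ κ)} {constant? (tail? R?) κ}
           (λ h i j → h (suc i) (suc j)) (extend κ c)) ⟩
    Σℤ.sum {q} (λ c → ΣV m λ κ → 𝟙 (constant? (tail? R?) κ))
      ≡⟨ Σℤ.sum-cong-≗ {q} (λ c → trans (ΣV-constant {q} (tail? R?) (on-suc R-eq)) (sym (ℤₚ.*-identityʳ N))) ⟩
    Σℤ.sum {q} (λ c → N * 1ℤ)
      ≡⟨ Σℤ.*-distribˡ-sum {q} N (λ _ → 1ℤ) ⟨
    N * Σℤ.sum {q} (λ _ → 1ℤ)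
      ≡⟨ cong (N *_) (sum-1 q) ⟩
    N * ℤ.+ q
      ≡⟨ ℤₚ.*-comm N (ℤ.+ q) ⟩
    (ℤ.+ q) ℤ.^ suc (#classes (tail? R?)) ∎
    where
    open ≡-Reasoning
    module R = IsEquivalence R-eq
    N = (ℤ.+ q) ℤ.^ #classes (tail? R?)
    extend : ∀ κ c → Constant (R on suc) κ → Constant R (c ∷ κ)
    extend κ c h zero    zero    r = refl
    extend κ c h zero    (suc j) r = contradiction (j , r) alone
    extend κ c h (suc i) zero    r = contradiction (i , R.sym r) alone
    extend κ c h (suc i) (suc j) r = h i j r

  -- The bond lattice of a graph

  module _ {m : ℕ} where

    blocks : {R : Rel (Fin m) 0ℓ} → B.Decidable R → Vec (Subset m) m
    blocks R? = tabulate λ i → tabulate λ j → does (R? i j)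

    module _ {R : Rel (Fin m) 0ℓ} (R? : B.Decidable R) {i j : Fin m} where

      private
        lookup-blocks : lookup (lookup (blocks R?) i) j ≡ does (R? i j)
        lookup-blocks = trans (cong (λ S → lookup S j) (Vecₚ.lookup∘tabulate (λ i → tabulate λ j → does (R? i j)) i))
          (Vecₚ.lookup∘tabulate (λ j → does (R? i j)) j)

      ∈-blocks⁻ : j ∈ lookup (blocks R?) i → R i j
      ∈-blocks⁻ j∈ with R? i j | trans (sym lookup-blocks) (Vecₚ.[]=⇒lookup j∈)
      ... | yes r | _ = r

      ∈-blocks⁺ : R i j → j ∈ lookup (blocks R?) i
      ∈-blocks⁺ r = Vecₚ.lookup⇒[]= j _ (trans lookup-blocks (dec-true (R? i j) r))

    SameBlock : Vec (Subset m) m → Rel (Fin m) 0ℓ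
    SameBlock b i j = j ∈ lookup b i

    sameBlock? : ∀ b → B.Decidable (SameBlock b)
    sameBlock? b i j = j ∈? lookup b i

    sameBlock-isEquivalence : ∀ {b} → IsPartition b → IsEquivalence (SameBlock b)
    sameBlock-isEquivalence {b} p = record
      { refl  = λ {i} → self i
      ; sym   = λ {i} {j} j∈ → subst (i ∈_) (sym (same i j j∈)) (self i)
      ; trans = λ {i} {j} {k} j∈ k∈ → subst (k ∈_) (same i j j∈) k∈
      }
      where open IsPartition p

    blocks-isPartition : ∀ {R : Rel (Fin m) 0ℓ} (R? : B.Decidable R) → IsEquivalence R → IsPartition (blocks R?)
    blocks-isPartition {R} R? R-eq = record
      { self = λ i → ∈-blocks⁺ R? R.refl
      ; same = λ i j j∈ → trans (Vecₚ.lookup∘tabulate _ j) (trans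
          (Vecₚ.tabulate-cong λ k → same-does (∈-blocks⁻ R? j∈) k)
          (sym (Vecₚ.lookup∘tabulate _ i)))
      }
      where
      module R = IsEquivalence R-eq
      same-does : ∀ {i j} → R i j → ∀ k → does (R? j k) ≡ does (R? i k)
      same-does {i} {j} r k with R? j k | R? i k
      ... | yes _ | yes _ = refl
      ... | yes s | no ¬s = contradiction (R.trans r s) ¬s
      ... | no ¬s | yes s = contradiction (R.trans (R.sym r) s) ¬s
      ... | no _  | no _  = refl

  module _ {m : ℕ} (G : Graph m) where
    open Graph G
    open FinitePoset (bondLattice G) using (Carrier; 0̂; elements; _≤?_; _<_; antisym; 0̂-minimum; μ; rk; len)
      renaming (_≈_ to _≈ᵇ_; _≤_ to _≤ᵇ_; _≟_ to _≟ᴮ_)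

    Within : Rel (Fin m) 0ℓ → Rel (Fin m) 0ℓ
    Within R v w = R v w × Edge v w

    blocks-isBond : ∀ {R : Rel (Fin m) 0ℓ} (R? : B.Decidable R) → IsEquivalence R →
                    (∀ {i j} → R i j → Star (Within R) i j) → IsBond G (blocks R?)
    blocks-isBond {R} R? R-eq R-path = blocks-isPartition R? R-eq , λ i v∈ w∈ →
        induced (∈-blocks⁻ R? v∈) (R-path (R.trans (R.sym (∈-blocks⁻ R? v∈)) (∈-blocks⁻ R? w∈)))
      where
      module R = IsEquivalence R-eq
      induced : ∀ {i v w} → R i v → Star (Within R) v w → Star (InducedEdge (lookup (blocks R?) i)) v w
      induced r ε             = ε
      induced r ((s , e) ◅ p) = (∈-blocks⁺ R? r , ∈-blocks⁺ R? (R.trans r s) , e) ◅ induced (R.trans r s) p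

    Rel-of : Carrier → Rel (Fin m) 0ℓ
    Rel-of (b , _) = SameBlock b

    rel? : ∀ x → B.Decidable (Rel-of x)
    rel? (b , _) = sameBlock? b

    rel-isEquivalence : ∀ x → IsEquivalence (Rel-of x)
    rel-isEquivalence (b , p , _) = sameBlock-isEquivalence p

    rel-path : ∀ x {i j} → Rel-of x i j → Star (Within (Rel-of x)) i j
    rel-path x@(b , p , conn) {i} {j} j∈ = Star.map
      (λ (v∈ , w∈ , e) → X.trans (X.sym v∈) w∈ , e) (conn i X.refl j∈)
      where module X = IsEquivalence (rel-isEquivalence x)

    ≤⇒⊆ : ∀ x y → x ≤ᵇ y → ∀ {i j} → Rel-of x i j → Rel-of y i j
    ≤⇒⊆ (b , p , _) (b′ , p′ , _) x≤y {i} = refines-⊆ p p′ x≤y i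

    ⊆⇒≤ : ∀ x y → (∀ {i j} → Rel-of x i j → Rel-of y i j) → x ≤ᵇ y
    ⊆⇒≤ x y x⊆y i = i , x⊆y

    #blocks : Carrier → ℕ
    #blocks x = #classes (rel? x)

    #blocks-antitone : ∀ x y → x ≤ᵇ y → #blocks y ℕ.≤ #blocks x
    #blocks-antitone x y x≤y = #classes-antitone (rel? x) (rel? y) λ i j → ≤⇒⊆ x y x≤y

    -- If every edge inside a block of y lay inside a block of x, walking along paths in the
    -- connected blocks of y would give y ≤ x. Decidability turns this contradiction into an actual
    -- edge.
    boundary : ∀ x y → x < y → ∃₂ λ a b → Rel-of y a b × Edge a b × ¬ Rel-of x a b
    boundary x y (x≤y , x≉y) = decidable-stable
        (any? λ a → any? λ b → rel? y a b ×-dec (edge? a b ×-dec ¬? (rel? x a b)))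
        λ none → x≉y (antisym {x} {y} x≤y (⊆⇒≤ y x λ r → walk none (rel-path y r)))
      where
      module X = IsEquivalence (rel-isEquivalence x)
      walk : ¬ (∃₂ λ a b → Rel-of y a b × Edge a b × ¬ Rel-of x a b) → ∀ {i j} → Star (Within (Rel-of y)) i j → Rel-of x i j
      walk none ε             = X.refl
      walk none {i} (_◅_ {j = k} (r , e) p) = X.trans
        (decidable-stable (rel? x i k) λ ¬r → none (i , k , r , e , ¬r)) (walk none p)

    -- The two blocks of x joined by a boundary edge are merged. That edge keeps the merged block
    -- connected, and since it lies inside a block of y the result stays below y.
    cover : ∀ x y → x < y → ∃[ z ] x < z × z ≤ᵇ y × suc (#blocks z) ≡ #blocks x
    cover x y x<y@(x≤y , x≉y) with boundary x y x<y
    ... | a , b , y-ab , e , ¬x-ab = z , (⊆⇒≤ x z (∈-blocks⁺ M? ∘ inj₁) , x≉z) , ⊆⇒≤ z y (M⊆y ∘ ∈-blocks⁻ M?) , (begin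
        suc (#blocks z)
          ≡⟨ cong suc (#classes-cong (rel? z) M? (λ i j → ∈-blocks⁻ M?) (λ i j → ∈-blocks⁺ M?)) ⟩
        suc (#classes M?)                 ≡⟨ #classes-merge (rel? x) (rel-isEquivalence x) ¬x-ab ⟩
        #blocks x                         ∎)
      where
      open ≡-Reasoning
      module X = IsEquivalence (rel-isEquivalence x)
      module Y = IsEquivalence (rel-isEquivalence y)
      M = Merge (Rel-of x) a b
      M? = merge? (Rel-of x) a b (rel? x)

      lift : ∀ {i j} → Rel-of x i j → Star (Within M) i j
      lift r = Star.map (λ (s , e) → inj₁ s , e) (rel-path x r)

      M-path : ∀ {i j} → M i j → Star (Within M) i j
      M-path (inj₁ r)              = lift r
      M-path (inj₂ (inj₁ (r , s))) = lift r ◅◅ (inj₂ (inj₁ (X.refl , X.refl)) , e) ◅ lift s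
      M-path (inj₂ (inj₂ (r , s))) = lift r ◅◅ (inj₂ (inj₂ (X.refl , X.refl)) , edge-sym e) ◅ lift s

      z : Carrier
      z = blocks M? , blocks-isBond M? (merge-isEquivalence (rel-isEquivalence x)) M-path

      x≉z : ¬ x ≈ᵇ z
      x≉z x≈z = ¬x-ab (subst (λ v → SameBlock v a b) (sym x≈z) (∈-blocks⁺ M? (inj₂ (inj₁ (X.refl , X.refl)))))

      M⊆y : ∀ {i j} → M i j → Rel-of y i j
      M⊆y (inj₁ r)              = ≤⇒⊆ x y x≤y r
      M⊆y (inj₂ (inj₁ (r , s))) = Y.trans (≤⇒⊆ x y x≤y r) (Y.trans y-ab (≤⇒⊆ x y x≤y s))
      M⊆y (inj₂ (inj₂ (r , s))) = Y.trans (≤⇒⊆ x y x≤y r) (Y.trans (Y.sym y-ab) (≤⇒⊆ x y x≤y s))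

    #blocks-strict : ∀ x y → x < y → #blocks y ℕ.< #blocks x
    #blocks-strict x y x<y with cover x y x<y
    ... | z , _ , z≤y , eq = subst (#blocks y ℕ.<_) eq (s≤s (#blocks-antitone z y z≤y))

    bond-grading : Grading (bondLattice G)
    bond-grading = record
      { g       = λ x → m ∸ #blocks x
      ; g-cong  = λ {x} {y} x≈y → cong (λ b → m ∸ #classes (sameBlock? b)) x≈y
      ; g-0̂     = trans (cong (m ∸_) (#classes-discrete (rel? 0̂) λ i∈ → sym (discrete-block i∈))) (ℕₚ.n∸n≡0 m)
      ; g-mono  = λ {x} {y} x<y → ℕₚ.∸-monoʳ-< (#blocks-strict x y x<y) (#classes-≤ (rel? x))
      ; g-cover = λ {z} {x} z<x → let (y , z<y , y≤x , eq) = cover z x z<x in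
          y , z<y , y≤x , trans
            -- The subtraction is exact here: one more than the number of blocks of y is the number
            -- of blocks of z, which is at most m.
            (ℕₚ.+-∸-assoc 1 {m} {suc (#blocks y)} (subst (ℕ._≤ m) (sym eq) (#classes-≤ (rel? z))))
            (cong (λ k → suc (m ∸ k)) eq)
      }

    rk≡m∸#blocks : ∀ x → rk x ≡ m ∸ #blocks x
    rk≡m∸#blocks = Grading.rk≡g bond-grading

    -- Monochromatic components and proper colourings

    module _ {q : ℕ} where

      Proper : Vec (Fin q) m → Set
      Proper κ = ∀ v w → Edge v w → lookup κ v ≢ lookup κ w

      abstract
        proper? : ∀ κ → Dec (Proper κ)
        proper? κ = all? λ v → all? λ w → edge? v w →-dec ¬? (lookup κ v ≟ᶠ lookup κ w)

      module _ (κ : Vec (Fin q) m) where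

        Mono : Rel (Fin m) 0ℓ
        Mono v w = Edge v w × lookup κ v ≡ lookup κ w

        mono-sym : B.Symmetric Mono
        mono-sym (e , eq) = edge-sym e , sym eq

        component? : B.Decidable (Star Mono)
        component? = Reachability.star? λ v w → edge? v w ×-dec (lookup κ v ≟ᶠ lookup κ w)

        component-isEquivalence : IsEquivalence (Star Mono)
        component-isEquivalence = record { refl = ε ; sym = Star.reverse mono-sym ; trans = _◅◅_ }

        component-path : ∀ {i j} → Star Mono i j → Star (Within (Star Mono)) i j
        component-path = Star.map λ { (e , eq) → (e , eq) ◅ ε , e }

        components : Carrier
        components = blocks component? , blocks-isBond component? component-isEquivalence component-path

        star-constant : ∀ {i j} → Star Mono i j → lookup κ i ≡ lookup κ j
        star-constant ε              = refl
        star-constant ((_ , eq) ◅ p) = trans eq (star-constant p)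

        ≤components⇒constant : ∀ x → x ≤ᵇ components → Constant (Rel-of x) κ
        ≤components⇒constant x x≤ i j r = star-constant (∈-blocks⁻ component? (≤⇒⊆ x components x≤ r))

        -- Blocks of a bond are connected, and when κ is constant on them every edge of a connecting
        -- path is monochromatic.
        constant⇒≤components : ∀ x → Constant (Rel-of x) κ → x ≤ᵇ components
        constant⇒≤components x h = ⊆⇒≤ x components λ r →
          ∈-blocks⁺ component? (Star.map (λ (s , e) → e , h _ _ s) (rel-path x r))

        0̂≈components⇒proper : 0̂ ≈ᵇ components → Proper κ
        0̂≈components⇒proper 0̂≈ v w e eq = edge-irrefl (sym (discrete-block {j = v}
          (subst (λ b → SameBlock b v w) (sym 0̂≈) (∈-blocks⁺ component? ((e , eq) ◅ ε))))) e

        proper⇒0̂≈components : Proper κ → 0̂ ≈ᵇ components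
        proper⇒0̂≈components prop = antisym {0̂} {components} (0̂-minimum components)
          (⊆⇒≤ components 0̂ λ r → trivial (∈-blocks⁻ component? r))
          where
          trivial : ∀ {i j} → Star Mono i j → Rel-of 0̂ i j
          trivial {i} ε              = discrete-self i
          trivial ((e , eq) ◅ _) = contradiction eq (prop _ _ e)

    -- With the power of q written as a sum over colourings constant on x, interchanging the sums
    -- leaves, for each κ, the sum of μ(0̂, x) over x ≤ `components κ`. This is 1 if the components
    -- are singletons, that is, if κ is proper, and 0 otherwise.
    Σμ-proper : ∀ q → ΣL elements (λ x → μ 0̂ x * (ℤ.+ q) ℤ.^ #blocks x) ≡ ΣV {q} m (λ κ → 𝟙 (proper? κ))
    Σμ-proper q = begin
      ΣL elements (λ x → μ 0̂ x * (ℤ.+ q) ℤ.^ #blocks x)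
        ≡⟨ ΣL-cong elements (λ x → trans
             (cong (μ 0̂ x *_) (sym (ΣV-constant {q} (rel? x) (rel-isEquivalence x))))
             (sym (ΣV-*ˡ {q} m (μ 0̂ x) λ κ → 𝟙 (constant? (rel? x) κ)))) ⟩
      ΣL elements (λ x → ΣV {q} m λ κ → μ 0̂ x * 𝟙 (constant? (rel? x) κ))
        ≡⟨ ΣV-ΣL {q} m elements (λ x κ → μ 0̂ x * 𝟙 (constant? (rel? x) κ)) ⟩
      ΣV {q} m (λ κ → ΣL elements λ x → μ 0̂ x * 𝟙 (constant? (rel? x) κ))
        ≡⟨ ΣV-cong {q} m (λ κ → begin
             ΣL elements (λ x → μ 0̂ x * 𝟙 (constant? (rel? x) κ))
               ≡⟨ ΣL-cong elements (λ x → trans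
                    (cong (μ 0̂ x *_) (𝟙-cong (constant⇒≤components κ x) (≤components⇒constant κ x)))
                    (ℤₚ.*-comm (μ 0̂ x) (𝟙 (x ≤? components κ)))) ⟩
             ΣL elements (λ x → 𝟙 (x ≤? components κ) * μ 0̂ x)
               ≡⟨ Σμ-below (bondLattice G) (components κ) ⟩
             𝟙 (0̂ ≟ᴮ components κ)
               ≡⟨ 𝟙-cong (0̂≈components⇒proper κ) (proper⇒0̂≈components κ) ⟩
             𝟙 (proper? κ) ∎) ⟩
      ΣV {q} m (λ κ → 𝟙 (proper? κ)) ∎
      where open ≡-Reasoning

  -- Corank in the bond lattice of a connected graph

  module _ {n : ℕ} (G : Graph (suc n)) (connected : ∀ v w → Star (Graph.Edge G) v w) where
    open FinitePoset (bondLattice G) using (Carrier; rk; len) renaming (_≤_ to _≤ᵇ_)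

    private
      Total : Rel (Fin (suc n)) 0ℓ
      Total _ _ = ⊤

      total? : B.Decidable Total
      total? _ _ = yes tt

      1̂ : Carrier
      1̂ = blocks total? , blocks-isBond G total? (record { refl = tt ; sym = λ _ → tt ; trans = λ _ _ → tt })
        (λ {i} {j} _ → Star.map (tt ,_) (connected i j))

      1̂-all : ∀ i j → Rel-of G 1̂ i j
      1̂-all i j = ∈-blocks⁺ total? {i} {j} tt

      1̂-maximum : ∀ x → x ≤ᵇ 1̂
      1̂-maximum x = ⊆⇒≤ G x 1̂ λ {i} {j} _ → 1̂-all i j

      #blocks-1̂ : #blocks G 1̂ ≡ 1
      #blocks-1̂ = #classes-total {n} {Rel-of G 1̂} (rel? G 1̂) 1̂-all

    -- Connectedness gives a top element with a single block, so the lattice on n + 1 vertices has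
    -- length n and the corank of x is one less than its number of blocks.
    suc-corank : ∀ x → suc (len ∸ rk x) ≡ #blocks G x
    suc-corank x = begin
      suc (len ∸ rk x)
        ≡⟨ cong₂ (λ a b → suc (a ∸ b)) (Grading.len≡g (bond-grading G) {1̂} 1̂-maximum) (rk≡m∸#blocks G x) ⟩
      suc (suc n ∸ #blocks G 1̂ ∸ (suc n ∸ #blocks G x))
        ≡⟨ cong (λ k → suc (suc n ∸ k ∸ (suc n ∸ #blocks G x))) #blocks-1̂ ⟩
      suc (n ∸ (suc n ∸ #blocks G x))
        ≡⟨ corank (#classes-≤ (rel? G x)) (subst (ℕ._≤ #blocks G x) #blocks-1̂ (#blocks-antitone G x 1̂ (1̂-maximum x))) ⟩
      #blocks G x                                 ∎
      where
      open ≡-Reasoning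
      corank : ∀ {k} → k ℕ.≤ suc n → 1 ℕ.≤ k → suc (n ∸ (suc n ∸ k)) ≡ k
      corank {suc k} (s≤s k≤n) _ = cong suc (ℕₚ.m∸[m∸n]≡n k≤n)

-- The characteristic polynomial of a connected graph

ι-^ : ∀ a n → ι (a ℤ.^ n) ≡ ι a Q.^ n
ι-^ a zero    = refl
ι-^ a (suc n) = trans (ι-* a (a ℤ.^ n)) (cong (ι a ℚ.*_) (ι-^ a n))

module _ {n : ℕ} (G : Graph (suc n)) (connected : ∀ v w → Star (Graph.Edge G) v w) where
  open FinitePoset (bondLattice G) using (Carrier; elements; μ; 0̂; rk; len)

  -- The extra factor x raises each exponent from the corank to the number of blocks, as `Σμ-proper`
  -- requires.
  eval-χ : ∀ q → let x = ι (ℤ.+ q) in x ℚ.* eval x (χ (bondLattice G)) ≡ ι (ΣV {q} (suc n) λ κ → 𝟙 (proper? G κ))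
  eval-χ q = trans (go elements) (cong ι (Σμ-proper G q))
    where
    open ≡-Reasoning
    open +-*-Solver using (solve; _:=_; _:+_; _:*_)
    x = ι (ℤ.+ q)

    summand : Carrier → Poly
    summand b = constₜ (μ 0̂ b ℚ./ 1) P.* t P.^ (len ∸ rk b)

    eval-summand : ∀ b → x ℚ.* eval x (summand b) ≡ ι (μ 0̂ b ℤ.* (ℤ.+ q) ℤ.^ #blocks G b)
    eval-summand b = begin
      x ℚ.* eval x (summand b)
        ≡⟨ cong (x ℚ.*_) (trans (eval-* x (constₜ (ι (μ 0̂ b))) (t P.^ (len ∸ rk b)))
             (cong₂ ℚ._*_ (eval-const x (ι (μ 0̂ b))) (trans (eval-^ x t (len ∸ rk b)) (cong (Q._^ (len ∸ rk b)) (eval-t x))))) ⟩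
      x ℚ.* (ι (μ 0̂ b) ℚ.* x Q.^ (len ∸ rk b))
        ≡⟨ solve 3 (λ x m p → x :* (m :* p) := m :* (x :* p)) refl x (ι (μ 0̂ b)) (x Q.^ (len ∸ rk b)) ⟩
      ι (μ 0̂ b) ℚ.* x Q.^ suc (len ∸ rk b)
        ≡⟨ cong (λ e → ι (μ 0̂ b) ℚ.* x Q.^ e) (suc-corank G connected b) ⟩
      ι (μ 0̂ b) ℚ.* x Q.^ #blocks G b
        ≡⟨ cong (ι (μ 0̂ b) ℚ.*_) (ι-^ (ℤ.+ q) (#blocks G b)) ⟨
      ι (μ 0̂ b) ℚ.* ι ((ℤ.+ q) ℤ.^ #blocks G b)
        ≡⟨ ι-* (μ 0̂ b) ((ℤ.+ q) ℤ.^ #blocks G b) ⟨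
      ι (μ 0̂ b ℤ.* (ℤ.+ q) ℤ.^ #blocks G b) ∎

    go : ∀ bs → x ℚ.* eval x (List.foldr P._+_ P.0# (List.map summand bs)) ≡ ι (ΣL bs λ b → μ 0̂ b ℤ.* (ℤ.+ q) ℤ.^ #blocks G b)
    go []       = ℚₚ.*-zeroʳ x
    go (b ∷ bs) = begin
      x ℚ.* eval x (summand b P.+ rest)              ≡⟨ cong (x ℚ.*_) (eval-+ x (summand b) rest) ⟩
      x ℚ.* (eval x (summand b) ℚ.+ eval x rest)     ≡⟨ ℚₚ.*-distribˡ-+ x (eval x (summand b)) (eval x rest) ⟩
      x ℚ.* eval x (summand b) ℚ.+ x ℚ.* eval x rest ≡⟨ cong₂ ℚ._+_ (eval-summand b) (go bs) ⟩
      ι (μ 0̂ b ℤ.* (ℤ.+ q) ℤ.^ #blocks G b) ℚ.+ ι (ΣL bs λ b → μ 0̂ b ℤ.* (ℤ.+ q) ℤ.^ #blocks G b)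
        ≡⟨ ι-+ (μ 0̂ b ℤ.* (ℤ.+ q) ℤ.^ #blocks G b) (ΣL bs λ b → μ 0̂ b ℤ.* (ℤ.+ q) ℤ.^ #blocks G b) ⟨
      ι (ΣL (b ∷ bs) λ b → μ 0̂ b ℤ.* (ℤ.+ q) ℤ.^ #blocks G b) ∎
      where
      rest : Poly
      rest = List.foldr P._+_ P.0# (List.map summand bs)

-- The graphs Γ n

-- `n * 2` unfolds by two vertices for each successor, which `2 * n` does not; colourings are
-- therefore counted on this index set and transported.
odd even : ∀ {n} → Fin n → Fin (n ℕ.* 2)
odd  zero    = zero
odd  (suc i) = suc (suc (odd i))
even zero    = suc zero
even (suc i) = suc (suc (even i))

odd⊎even : ∀ {n} (v : Fin (n ℕ.* 2)) → ∃[ i ] (v ≡ odd {n} i ⊎ v ≡ even {n} i)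
odd⊎even {suc n} zero          = zero , inj₁ refl
odd⊎even {suc n} (suc zero)    = zero , inj₂ refl
odd⊎even {suc n} (suc (suc v)) with odd⊎even {n} v
... | i , inj₁ eq = suc i , inj₁ (cong (λ w → suc (suc w)) eq)
... | i , inj₂ eq = suc i , inj₂ (cong (λ w → suc (suc w)) eq)

toℕ-odd : ∀ {n} (i : Fin n) → toℕ (odd i) ≡ toℕ i ℕ.* 2
toℕ-odd zero    = refl
toℕ-odd (suc i) = cong (λ k → suc (suc k)) (toℕ-odd i)

toℕ-even : ∀ {n} (i : Fin n) → toℕ (even i) ≡ suc (toℕ i ℕ.* 2)
toℕ-even zero    = refl
toℕ-even (suc i) = cong (λ k → suc (suc k)) (toℕ-even i)

toℕ-subst : ∀ {m n} (eq : m ≡ n) (i : Fin m) → toℕ (subst Fin eq i) ≡ toℕ i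
toℕ-subst refl i = refl

module _ (n : ℕ) where
  open Graph (Γ n)

  vertex : Fin (n ℕ.* 2) → Fin (2 ℕ.* n)
  vertex = subst Fin (ℕₚ.*-comm n 2)

  label-odd : ∀ (i : Fin n) → label (vertex (odd i)) ≡ 2 ℕ.* label i ∸ 1
  label-odd i = begin
    suc (toℕ (vertex (odd i)))     ≡⟨ cong suc (trans (toℕ-subst (ℕₚ.*-comm n 2) (odd i)) (toℕ-odd i)) ⟩
    suc (toℕ i ℕ.* 2)              ≡⟨ cong suc (ℕₚ.*-comm (toℕ i) 2) ⟩
    suc (toℕ i ℕ.+ (toℕ i ℕ.+ 0))  ≡⟨ ℕₚ.+-suc (toℕ i) (toℕ i ℕ.+ 0) ⟨
    2 ℕ.* label i ∸ 1              ∎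
    where open ≡-Reasoning

  label-even : ∀ (i : Fin n) → label (vertex (even i)) ≡ 2 ℕ.* label i
  label-even i = begin
    suc (toℕ (vertex (even i)))    ≡⟨ cong suc (trans (toℕ-subst (ℕₚ.*-comm n 2) (even i)) (toℕ-even i)) ⟩
    suc (suc (toℕ i ℕ.* 2))        ≡⟨ ℕₚ.*-comm (label i) 2 ⟩
    2 ℕ.* label i                  ∎
    where open ≡-Reasoning

  label-injective : ∀ {m} {v w : Fin m} → label v ≡ label w → v ≡ w
  label-injective = Finₚ.toℕ-injective ∘ ℕₚ.suc-injective

  edge : ∀ {i j : Fin n} → i Fin.≤ j → Edge (vertex (odd i)) (vertex (even j))
  edge {i} {j} i≤j = i , j , i≤j , inj₁ (label-odd i , label-even j)

  vertex-odd⊎even : ∀ v → ∃[ i ] (v ≡ vertex (odd {n} i) ⊎ v ≡ vertex (even {n} i))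
  vertex-odd⊎even v = lift (ℕₚ.*-comm n 2) v
    where
    lift : ∀ {m} (eq : n ℕ.* 2 ≡ m) v → ∃[ i ] (v ≡ subst Fin eq (odd {n} i) ⊎ v ≡ subst Fin eq (even {n} i))
    lift refl = odd⊎even {n}

  module _ {q : ℕ} where

    -- The equation is a parameter so that the count can be moved between `2 * n` and `n * 2` by
    -- matching it with `refl`.
    GoodΓ : ∀ {m} → n ℕ.* 2 ≡ m → Vec (Fin q) m → Set
    GoodΓ eq κ = ∀ (i j : Fin n) → i Fin.≤ j → lookup κ (subst Fin eq (odd i)) ≢ lookup κ (subst Fin eq (even j))

    proper⇒good : ∀ κ → Proper (Γ n) κ → GoodΓ (ℕₚ.*-comm n 2) κ
    proper⇒good κ prop i j i≤j = prop _ _ (edge i≤j)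

    good⇒proper : ∀ κ → GoodΓ (ℕₚ.*-comm n 2) κ → Proper (Γ n) κ
    good⇒proper κ good v w (i , j , i≤j , inj₁ (v≡ , w≡)) eq = good i j i≤j
      (trans (cong (lookup κ) (label-injective (trans (label-odd i) (sym v≡))))
        (trans eq (cong (lookup κ) (label-injective (trans w≡ (sym (label-even j)))))))
    good⇒proper κ good v w (i , j , i≤j , inj₂ (w≡ , v≡)) eq = good i j i≤j
      (trans (cong (lookup κ) (label-injective (trans (label-odd i) (sym w≡))))
        (trans (sym eq) (cong (lookup κ) (label-injective (trans v≡ (sym (label-even j)))))))

-- Vertex 1, the hub, is adjacent to every even vertex, and the last vertex is adjacent to every odd
-- one.
Γ-connected : ∀ n v w → Star (Graph.Edge (Γ (suc n))) v w
Γ-connected n v w = to-hub v ◅◅ Star.reverse edge-sym (to-hub w)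
  where
  open Graph (Γ (suc n))
  hub = vertex (suc n) (odd {suc n} zero)

  even-hub : ∀ j → Edge (vertex (suc n) (even j)) hub
  even-hub j = edge-sym (edge (suc n) {zero} {j} z≤n)

  to-hub : ∀ v → Star Edge v hub
  to-hub v with vertex-odd⊎even (suc n) v
  ... | i , inj₁ refl = edge (suc n) {i} {fromℕ n} (Finₚ.≤fromℕ i) ◅ even-hub (fromℕ n) ◅ ε
  ... | j , inj₂ refl = even-hub j ◅ ε

-- Counting the proper colourings

module _ {q : ℕ} where

  Colours : Set
  Colours = Fin q → Bool

  add : Colours → Fin q → Colours
  add S a c = does (c ≟ᶠ a) ∨ S c

  add-false⁻ : ∀ S a c → add S a c ≡ false → a ≢ c × S c ≡ false
  add-false⁻ S a c eq with c ≟ᶠ a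
  add-false⁻ S a c () | yes _
  ... | no c≢a = c≢a ∘ sym , eq

  add-false⁺ : ∀ S a c → a ≢ c → S c ≡ false → add S a c ≡ false
  add-false⁺ S a c a≢c eq with c ≟ᶠ a
  ... | yes c≡a = contradiction (sym c≡a) a≢c
  ... | no _    = eq

  -- `S` holds the colours of the odd vertices already peeled off. These are adjacent to all
  -- remaining even vertices and to no remaining odd one, so avoiding `S` on even vertices is their
  -- whole effect.
  Good : ∀ n → Colours → Vec (Fin q) (n ℕ.* 2) → Set
  Good n S κ = (∀ (j : Fin n) → S (lookup κ (even j)) ≡ false) × GoodΓ n refl κ

  abstract
    good? : ∀ n S κ → Dec (Good n S κ)
    good? n S κ = (all? λ j → S (lookup κ (even j)) ≟ᵇ false) ×-dec
      (all? λ i → all? λ j → (i ≤ᶠ? j) →-dec ¬? (lookup κ (odd i) ≟ᶠ lookup κ (even j)))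

  good-∷⁻ : ∀ n S a b κ → Good (suc n) S (a ∷ b ∷ κ) → add S a b ≡ false × Good n (add S a) κ
  good-∷⁻ n S a b κ (avoid , good) =
    add-false⁺ S a b (good zero zero z≤n) (avoid zero) ,
    (λ j → add-false⁺ S a (lookup κ (even j)) (good zero (suc j) z≤n) (avoid (suc j))) ,
    λ i j i≤j → good (suc i) (suc j) (s≤s i≤j)

  good-∷⁺ : ∀ n S a b κ → add S a b ≡ false × Good n (add S a) κ → Good (suc n) S (a ∷ b ∷ κ)
  good-∷⁺ n S a b κ (b∉ , avoid , good) = avoid′ , good′
    where
    avoid′ : ∀ j → S (lookup (a ∷ b ∷ κ) (even j)) ≡ false
    avoid′ zero    = proj₂ (add-false⁻ S a b b∉)
    avoid′ (suc j) = proj₂ (add-false⁻ S a (lookup κ (even j)) (avoid j))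

    good′ : GoodΓ (suc n) refl (a ∷ b ∷ κ)
    good′ zero    zero    _         = proj₁ (add-false⁻ S a b b∉)
    good′ zero    (suc j) _         = proj₁ (add-false⁻ S a (lookup κ (even j)) (avoid j))
    good′ (suc i) (suc j) (s≤s i≤j) = good i j i≤j

  [_] : Bool → ℤ
  [ b ] = if b then 1ℤ else 0ℤ

  card : Colours → ℤ
  card S = Σℤ.sum λ c → [ S c ]

  card-add-∈ : ∀ S a → S a ≡ true → card (add S a) ≡ card S
  card-add-∈ S a Sa = Σℤ.sum-cong-≗ {q} λ c → cong [_] (absorb c)
    where
    absorb : ∀ c → add S a c ≡ S c
    absorb c with c ≟ᶠ a
    ... | yes refl = sym Sa
    ... | no _     = refl

  card-add-∉ : ∀ S a → S a ≡ false → card (add S a) ≡ 1ℤ ℤ.+ card S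
  card-add-∉ S a Sa = begin
    card (add S a)
      ≡⟨ Σℤ.sum-cong-≗ {q} split ⟩
    Σℤ.sum {q} (λ c → 𝟙 (c ≟ᶠ a) ℤ.+ [ S c ])
      ≡⟨ Σℤ.∑-distrib-+ {q} (λ c → 𝟙 (c ≟ᶠ a)) (λ c → [ S c ]) ⟩
    Σℤ.sum {q} (λ c → 𝟙 (c ≟ᶠ a)) ℤ.+ card S
      ≡⟨ cong (ℤ._+ card S) (sum-𝟙≡ a) ⟩
    1ℤ ℤ.+ card S ∎
    where
    open ≡-Reasoning
    split : ∀ c → [ add S a c ] ≡ 𝟙 (c ≟ᶠ a) ℤ.+ [ S c ]
    split c with c ≟ᶠ a
    ... | yes refl = sym (trans (cong₂ (λ x b → x ℤ.+ [ b ]) (𝟙-yes {A? = yes refl} refl) Sa) refl)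
    ... | no c≢a   = sym (trans (cong (ℤ._+ [ S c ]) (𝟙-no {A? = no c≢a} c≢a)) (ℤₚ.+-identityˡ _))

  sum-complement : ∀ S → Σℤ.sum {q} (λ c → 𝟙 (S c ≟ᵇ false)) ≡ ℤ.+ q ℤ.- card S
  sum-complement S = begin
    N                         ≡⟨ cancel N (card S) ⟩
    N ℤ.+ card S ℤ.- card S   ≡⟨ cong (ℤ._- card S) (Σℤ.∑-distrib-+ {q} (λ c → 𝟙 (S c ≟ᵇ false)) (λ c → [ S c ])) ⟨
    Σℤ.sum {q} (λ c → 𝟙 (S c ≟ᵇ false) ℤ.+ [ S c ]) ℤ.- card S
      ≡⟨ cong (ℤ._- card S) (trans (Σℤ.sum-cong-≗ {q} λ c → either (S c)) (sum-1 q)) ⟩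
    ℤ.+ q ℤ.- card S          ∎
    where
    open ≡-Reasoning
    N = Σℤ.sum {q} λ c → 𝟙 (S c ≟ᵇ false)
    cancel : ∀ a b → a ≡ a ℤ.+ b ℤ.- b
    cancel = solve-∀
    either : ∀ b → 𝟙 (b ≟ᵇ false) ℤ.+ [ b ] ≡ 1ℤ
    either true  = cong (ℤ._+ 1ℤ) (𝟙-no {A? = true ≟ᵇ false} λ ())
    either false = cong (ℤ._+ 0ℤ) (𝟙-yes {A? = false ≟ᵇ false} refl)

  -- The path recursion of `Φ` over the integers, started at height k; the height is an integer so
  -- that `card S` can be inserted.
  #colourings : ℕ → ℤ → ℤ
  #colourings zero    k = 1ℤ
  #colourings (suc n) k = k ℤ.* (ℤ.+ q ℤ.- k) ℤ.* #colourings n k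
    ℤ.+ (ℤ.+ q ℤ.- k) ℤ.* ((ℤ.+ q ℤ.- 1ℤ) ℤ.- k) ℤ.* #colourings n (1ℤ ℤ.+ k)

  -- Once the first odd vertex has colour a, its even successor has q - `card (add S a)` choices,
  -- and `card` grows by one precisely when a is new. Thus the count depends on `S` only through its
  -- size.
  ΣV-good : ∀ n S → ΣV {q} (n ℕ.* 2) (λ κ → 𝟙 (good? n S κ)) ≡ #colourings n (card S)
  ΣV-good zero    S = 𝟙-yes {A? = good? 0 S []} ((λ ()) , λ ())
  ΣV-good (suc n) S = begin
    Σℤ.sum {q} (λ a → Σℤ.sum {q} λ b → ΣV {q} (n ℕ.* 2) λ κ → 𝟙 (good? (suc n) S (a ∷ b ∷ κ)))
      ≡⟨ Σℤ.sum-cong-≗ {q} (λ a → trans (Σℤ.sum-cong-≗ {q} λ b → inner a b) (outer a)) ⟩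
    Σℤ.sum {q} (λ a → 𝟙 (S a ≟ᵇ false) ℤ.* new ℤ.+ [ S a ] ℤ.* old)
      ≡⟨ Σℤ.∑-distrib-+ {q} (λ a → 𝟙 (S a ≟ᵇ false) ℤ.* new) (λ a → [ S a ] ℤ.* old) ⟩
    Σℤ.sum {q} (λ a → 𝟙 (S a ≟ᵇ false) ℤ.* new) ℤ.+ Σℤ.sum {q} (λ a → [ S a ] ℤ.* old)
      ≡⟨ cong₂ ℤ._+_ (Σℤ.*-distribʳ-sum {q} new (λ a → 𝟙 (S a ≟ᵇ false))) (Σℤ.*-distribʳ-sum {q} old (λ a → [ S a ])) ⟨
    Σℤ.sum {q} (λ a → 𝟙 (S a ≟ᵇ false)) ℤ.* new ℤ.+ k ℤ.* old
      ≡⟨ cong (λ c → c ℤ.* new ℤ.+ k ℤ.* old) (sum-complement S) ⟩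
    (ℤ.+ q ℤ.- k) ℤ.* new ℤ.+ k ℤ.* old
      ≡⟨ rearrange (ℤ.+ q) k (#colourings n k) (#colourings n (1ℤ ℤ.+ k)) ⟩
    #colourings (suc n) k ∎
    where
    open ≡-Reasoning
    k = card S
    remaining : ℤ → ℤ
    remaining k = (ℤ.+ q ℤ.- k) ℤ.* #colourings n k
    old = remaining k
    new = remaining (1ℤ ℤ.+ k)

    rearrange : ∀ q k x y → (q ℤ.- k) ℤ.* ((q ℤ.- (1ℤ ℤ.+ k)) ℤ.* y) ℤ.+ k ℤ.* ((q ℤ.- k) ℤ.* x) ≡
      k ℤ.* (q ℤ.- k) ℤ.* x ℤ.+ (q ℤ.- k) ℤ.* ((q ℤ.- 1ℤ) ℤ.- k) ℤ.* y
    rearrange = solve-∀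

    inner : ∀ a b → ΣV {q} (n ℕ.* 2) (λ κ → 𝟙 (good? (suc n) S (a ∷ b ∷ κ))) ≡
      𝟙 (add S a b ≟ᵇ false) ℤ.* #colourings n (card (add S a))
    inner a b = begin
      ΣV {q} (n ℕ.* 2) (λ κ → 𝟙 (good? (suc n) S (a ∷ b ∷ κ)))
        ≡⟨ ΣV-cong {q} (n ℕ.* 2) (λ κ → trans
             (𝟙-cong {B? = (add S a b ≟ᵇ false) ×-dec good? n (add S a) κ} (good-∷⁻ n S a b κ) (good-∷⁺ n S a b κ))
             (𝟙-× (add S a b ≟ᵇ false) (good? n (add S a) κ))) ⟩
      ΣV {q} (n ℕ.* 2) (λ κ → 𝟙 (add S a b ≟ᵇ false) ℤ.* 𝟙 (good? n (add S a) κ))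
        ≡⟨ ΣV-*ˡ {q} (n ℕ.* 2) (𝟙 (add S a b ≟ᵇ false)) (λ κ → 𝟙 (good? n (add S a) κ)) ⟩
      𝟙 (add S a b ≟ᵇ false) ℤ.* ΣV {q} (n ℕ.* 2) (λ κ → 𝟙 (good? n (add S a) κ))
        ≡⟨ cong (𝟙 (add S a b ≟ᵇ false) ℤ.*_) (ΣV-good n (add S a)) ⟩
      𝟙 (add S a b ≟ᵇ false) ℤ.* #colourings n (card (add S a)) ∎

    -- The first summand treats a new colour a, the second a repeated one.
    by-case : ∀ a c → S a ≡ c → remaining (card (add S a)) ≡ 𝟙 (c ≟ᵇ false) ℤ.* new ℤ.+ [ c ] ℤ.* old
    by-case a true Sa = trans (cong remaining (card-add-∈ S a Sa)) (sym (trans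
      (cong₂ ℤ._+_ (𝟙-no-* (true ≟ᵇ false) new λ ()) (ℤₚ.*-identityˡ old)) (ℤₚ.+-identityˡ old)))
    by-case a false Sa = trans (cong remaining (card-add-∉ S a Sa)) (sym (trans
      (cong (ℤ._+ 0ℤ ℤ.* old) (𝟙-yes-* (false ≟ᵇ false) new refl)) (ℤₚ.+-identityʳ new)))

    outer : ∀ a → Σℤ.sum {q} (λ b → 𝟙 (add S a b ≟ᵇ false) ℤ.* #colourings n (card (add S a))) ≡
      𝟙 (S a ≟ᵇ false) ℤ.* new ℤ.+ [ S a ] ℤ.* old
    outer a = begin
      Σℤ.sum {q} (λ b → 𝟙 (add S a b ≟ᵇ false) ℤ.* #colourings n (card (add S a)))
        ≡⟨ Σℤ.*-distribʳ-sum {q} (#colourings n (card (add S a))) (λ b → 𝟙 (add S a b ≟ᵇ false)) ⟨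
      Σℤ.sum {q} (λ b → 𝟙 (add S a b ≟ᵇ false)) ℤ.* #colourings n (card (add S a))
        ≡⟨ cong (ℤ._* #colourings n (card (add S a))) (sum-complement (add S a)) ⟩
      remaining (card (add S a))
        ≡⟨ by-case a (S a) refl ⟩
      𝟙 (S a ≟ᵇ false) ℤ.* new ℤ.+ [ S a ] ℤ.* old ∎

  ΣV-proper : ∀ n → ΣV {q} (2 ℕ.* n) (λ κ → 𝟙 (proper? (Γ n) κ)) ≡ #colourings n 0ℤ
  ΣV-proper n = begin
    ΣV {q} (2 ℕ.* n) (λ κ → 𝟙 (proper? (Γ n) κ))
      ≡⟨ ΣV-cong {q} (2 ℕ.* n) (λ κ → 𝟙-cong {B? = goodΓ? (ℕₚ.*-comm n 2) κ} (proper⇒good n κ) (good⇒proper n κ)) ⟩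
    ΣV {q} (2 ℕ.* n) (λ κ → 𝟙 (goodΓ? (ℕₚ.*-comm n 2) κ))
      ≡⟨ transport (ℕₚ.*-comm n 2) ⟩
    ΣV {q} (n ℕ.* 2) (λ κ → 𝟙 (goodΓ? refl κ))
      ≡⟨ ΣV-cong {q} (n ℕ.* 2) (λ κ → 𝟙-cong {B? = good? n ∅ κ} (λ good → (λ _ → refl) , good) proj₂) ⟩
    ΣV {q} (n ℕ.* 2) (λ κ → 𝟙 (good? n ∅ κ))
      ≡⟨ ΣV-good n ∅ ⟩
    #colourings n (card ∅)
      ≡⟨ cong (#colourings n) (Σℤ.sum-replicate-zero q) ⟩
    #colourings n 0ℤ ∎
    where
    open ≡-Reasoning
    ∅ : Colours
    ∅ _ = false

    goodΓ? : ∀ {m} (eq : n ℕ.* 2 ≡ m) κ → Dec (GoodΓ n eq κ)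
    goodΓ? eq κ = all? λ i → all? λ j → (i ≤ᶠ? j) →-dec
      ¬? (lookup κ (subst Fin eq (odd i)) ≟ᶠ lookup κ (subst Fin eq (even j)))

    transport : ∀ {m} (eq : n ℕ.* 2 ≡ m) → ΣV {q} m (λ κ → 𝟙 (goodΓ? eq κ)) ≡ ΣV {q} (n ℕ.* 2) (λ κ → 𝟙 (goodΓ? refl κ))
    transport refl = refl

  -- `Φ` shifts its weights by composing with `suc`, while here k increases. The two agree only up
  -- to k + (1 + i) = (1 + k) + i, so the weights are general functions known pointwise.
  ι-#colourings : ∀ n k {X Y : ℕ → ℚ} → let x = ι (ℤ.+ q) in
    (∀ i → X i ≡ flat x (k ℕ.+ i)) → (∀ i → Y i ≡ rise x (k ℕ.+ i)) → ι (#colourings n (ℤ.+ k)) ≡ Φ X Y n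
  ι-#colourings zero    k X≗ Y≗ = refl
  ι-#colourings (suc n) k {X} {Y} X≗ Y≗ = begin
    ι (#colourings (suc n) K)
      ≡⟨ ι-+ (K ℤ.* (ℤ.+ q ℤ.- K) ℤ.* C₀) ((ℤ.+ q ℤ.- K) ℤ.* ((ℤ.+ q ℤ.- 1ℤ) ℤ.- K) ℤ.* C₁) ⟩
    ι (K ℤ.* (ℤ.+ q ℤ.- K) ℤ.* C₀) ℚ.+ ι ((ℤ.+ q ℤ.- K) ℤ.* ((ℤ.+ q ℤ.- 1ℤ) ℤ.- K) ℤ.* C₁)
      ≡⟨ cong₂ ℚ._+_ (ι-* (K ℤ.* (ℤ.+ q ℤ.- K)) C₀) (ι-* ((ℤ.+ q ℤ.- K) ℤ.* ((ℤ.+ q ℤ.- 1ℤ) ℤ.- K)) C₁) ⟩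
    ι (K ℤ.* (ℤ.+ q ℤ.- K)) ℚ.* ι C₀ ℚ.+ ι ((ℤ.+ q ℤ.- K) ℤ.* ((ℤ.+ q ℤ.- 1ℤ) ℤ.- K)) ℚ.* ι C₁
      ≡⟨ cong₂ (λ a b → a ℚ.* ι C₀ ℚ.+ b ℚ.* ι C₁) ι-flat ι-rise ⟩
    flat x k ℚ.* ι C₀ ℚ.+ rise x k ℚ.* ι C₁
      ≡⟨ cong₂ (λ a b → a ℚ.* ι C₀ ℚ.+ b ℚ.* ι C₁)
           (sym (trans (X≗ 0) (cong (flat x) (ℕₚ.+-identityʳ k))))
           (sym (trans (Y≗ 0) (cong (rise x) (ℕₚ.+-identityʳ k)))) ⟩
    X 0 ℚ.* ι C₀ ℚ.+ Y 0 ℚ.* ι C₁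
      ≡⟨ cong₂ (λ a b → X 0 ℚ.* a ℚ.+ Y 0 ℚ.* b) (ι-#colourings n k X≗ Y≗)
           (ι-#colourings n (suc k)
             (λ i → trans (X≗ (suc i)) (cong (flat x) (ℕₚ.+-suc k i)))
             (λ i → trans (Y≗ (suc i)) (cong (rise x) (ℕₚ.+-suc k i)))) ⟩
    Φ X Y (suc n) ∎
    where
    open ≡-Reasoning
    x = ι (ℤ.+ q)
    K = ℤ.+ k
    C₀ = #colourings n K
    C₁ = #colourings n (1ℤ ℤ.+ K)

    ι-− : ∀ a b → ι (a ℤ.- b) ≡ ι a ℚ.- ι b
    ι-− a b = trans (ι-+ a (ℤ.- b)) (cong (ι a ℚ.+_) (ι-neg b))

    ι-flat : ι (K ℤ.* (ℤ.+ q ℤ.- K)) ≡ flat x k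
    ι-flat = trans (ι-* K (ℤ.+ q ℤ.- K)) (trans (cong (ι K ℚ.*_) (ι-− (ℤ.+ q) K))
      (cong (λ y → y ℚ.* (x ℚ.- y)) (sym (fromℕ≡ι k))))

    ι-rise : ι ((ℤ.+ q ℤ.- K) ℤ.* ((ℤ.+ q ℤ.- 1ℤ) ℤ.- K)) ≡ rise x k
    ι-rise = trans (ι-* (ℤ.+ q ℤ.- K) ((ℤ.+ q ℤ.- 1ℤ) ℤ.- K))
      (trans (cong₂ ℚ._*_ (ι-− (ℤ.+ q) K) (trans (ι-− (ℤ.+ q ℤ.- 1ℤ) K) (cong (ℚ._- ι K) (ι-− (ℤ.+ q) 1ℤ))))
        (cong (λ y → (x ℚ.- y) ℚ.* ((x ℚ.- 1ℚ) ℚ.- y)) (sym (fromℕ≡ι k))))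

χ-countsPaths : CountsPaths λ n → χ (bondLattice (Γ n))
χ-countsPaths k n = begin
  x ℚ.* eval x (χ (bondLattice (Γ (suc n))))     ≡⟨ eval-χ (Γ (suc n)) (Γ-connected n) (suc k) ⟩
  ι (ΣV {suc k} (2 ℕ.* suc n) λ κ → 𝟙 (proper? (Γ (suc n)) κ))  ≡⟨ cong ι (ΣV-proper {suc k} (suc n)) ⟩
  ι (#colourings {suc k} (suc n) 0ℤ)             ≡⟨ ι-#colourings {suc k} (suc n) 0 (λ _ → refl) (λ _ → refl) ⟩
  Φ (flat x) (rise x) (suc n)                    ∎
  where
  open ≡-Reasoning
  x = ι (ℤ.+ suc k)

theorem5p5 : ∃[ s ]
    Σ≥1 (λ n → constᵤ (χ (bondLattice (Γ n))) *ᵤ (u ^ᵤ n)) HasSum s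
    ×
    Σ≥1 (λ n →
    constᵤ (fallingₜ (t -ₜ 1ₜ) n *ₜ fallingₜ (t -ₜ 1ₜ) (n ∸ 1)) *ᵤ (u ^ᵤ n)
    *ᵤ inverse (productᵤ {n} λ i →
    1ᵤ -ᵤ (constᵤ (fromℕₜ (suc (toℕ i)) *ₜ (t -ₜ fromℕₜ (suc (toℕ i)))) *ᵤ u)))
    HasSum s
theorem5p5 = limit c , monomials-HasSum c χ-countsPaths , terms-HasSum c χ-countsPaths
  where
  c : ℕ → Poly
  c n = χ (bondLattice (Γ n))
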